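{- Let $G=(V,E)$ be a simple undirected graph with $V=\{1,\dots,n\}$. The polynomial system over $\mathbb{F}_2$ encoding the $3$-colorability of $G$, $$J_G=\{x_i^3+1=0,\ \ x_i^2+x_ix_j+x_j^2=0 \ :\ i\in V,\ \{i,j\}\in E\},$$ has a degree one Nullstellensatz certificate of infeasibility if and only if there exists a set $C$ of oriented partial $3$-cycles and oriented chordless $4$-cycles from $\mathrm{Arcs}(G)$ such that (1) $|C_{(i,j)}|+|C_{(j,i)}|\equiv 0 \pmod 2$ for all $\{i,j\}\in E$, and (2) $\sum_{(i,j)\in \mathrm{Arcs}(G),\, i<j}|C_{(i,j)}|\equiv 1\pmod 2$, where $C_{(i,j)}$ denotes the set of cycles in $C$ in which the arc $(i,j)\in \mathrm{Arcs}(G)$ appears. Moreover, the class of non-3-colorable graphs $G$ whose encodings $J_G$ have degree one Nullstellensatz infeasibility certificates can be recognized in polynomial time.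
   Context: $\mathrm{Arcs}(G)=\{(i,j): i,j\in V,\ \{i,j\}\in E\}$ (both orientations of each edge). A degree one Nullstellensatz certificate of infeasibility for $J_G$ is an identity in $\mathbb{F}_2[x_1,\dots,x_n]$ of the form $$\sum_{i\in V}\Big(a_i+\sum_{j\in V}a_{ij}x_j\Big)(x_i^3+1)+\sum_{\{i,j\}\in E}\Big(b_{ij}+\sum_{k\in V}b_{ijk}x_k\Big)(x_i^2+x_ix_j+x_j^2)=1$$ with all coefficients $a_i,a_{ij},b_{ij},b_{ijk}\in\mathbb{F}_2$. An oriented partial $3$-cycle is a pair of arcs $\{(i,j),(j,k)\}\subseteq \mathrm{Arcs}(G)$, denoted $(i,j,k)$, such that $(k,i)\in\mathrm{Arcs}(G)$; its arcs are $(i,j)$ and $(j,k)$ only. An oriented chordless $4$-cycle is a set of four arcs $\{(i,j),(j,k),(k,l),(l,i)\}\subseteq\mathrm{Arcs}(G)$, denoted $(i,j,k,l)$, with $i,j,k,l$ distinct and $(i,k),(j,l)\notin\mathrm{Arcs}(G)$. "Recognized in polynomial time" means that there is an algorithm which, given a simple undirected graph $G$, decides in time polynomial in the size of $G$ whether $J_G$ has a degree one Nullstellensatz certificate. -}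

module Defs where

open import Data.Bool.Base using (Bool; true; false; _xor_; _∧_) renaming (if_then_else_ to ifᵇ_then_else_)
open import Data.Fin.Base using (Fin; zero; _<_)
import Data.Fin.Properties as Fin
open import Data.List.Base
  using (List; []; _∷_; _++_; map; foldr; length; filter; allFin; cartesianProduct; cartesianProductWith)
open import Data.List.Relation.Binary.BagAndSetEquality using ([_]-Equality; set)
import Data.List.Membership.DecPropositional as DecMembership
import Data.List.Relation.Unary.Unique.Propositional as Propositional
import Data.List.Relation.Unary.Unique.Setoid as Setoidal
open import Data.Nat.Base as ℕ using (ℕ; zero; suc)
import Data.Nat.Properties as ℕ
open import Data.Product.Base using (Σ; ∃-syntax; _×_; _,_)
open import Data.Product.Properties using (≡-dec)
open import Data.Vec.Base as Vec using (Vec; _[_]≔_)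
import Data.Vec.Properties as Vec
open import Level using (0ℓ)
open import Relation.Binary.Bundles using (Setoid)
open import Relation.Binary.Core using (Rel)
import Relation.Binary.Construct.On as On
open import Relation.Binary.Definitions using (Decidable; Symmetric; Irreflexive; DecidableEquality)
open import Relation.Binary.PropositionalEquality.Core using (_≡_; _≢_)
open import Relation.Nullary using (¬_; does; Reflects)

record Graph (n : ℕ) : Set₁ where
  field
    Adj    : Rel (Fin n) 0ℓ
    adj?   : Decidable Adj
    sym    : Symmetric Adj
    irrefl : Irreflexive _≡_ Adj

open Graph public

Arc : ℕ → Set
Arc n = Fin n × Fin n

_≟ᵃ_ : ∀ {n} → DecidableEquality (Arc n)
_≟ᵃ_ = ≡-dec Fin._≟_ Fin._≟_

-- Both orientations of every edge, each arc listed once.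
arcs : ∀ {n} → Graph n → List (Arc n)
arcs {n} G = filter (λ (i , j) → adj? G i j) (cartesianProduct (allFin n) (allFin n))

-- The arcs (i , j) with i < j: exactly one orientation of each edge, so
-- this list also serves as the edge set E.
upArcs : ∀ {n} → Graph n → List (Arc n)
upArcs G = filter (λ (i , j) → i Fin.<? j) (arcs G)

ThreeColorable : ∀ {n} → Graph n → Set
ThreeColorable {n} G =
  Σ (Fin n → Fin 3) λ f → ∀ {i j} → Adj G i j → f i ≢ f j

-- 𝔽₂ is the ring Data.Bool.Properties.xor-∧-commutativeRing.
𝔽₂ : Set
𝔽₂ = Bool

Monomial : ℕ → Set
Monomial n = Vec ℕ n

-- A polynomial is a formal sum of terms; the same monomial may occur in
-- several terms, and equality _≈_ is equality of all coefficients.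
Poly : ℕ → Set
Poly n = List (𝔽₂ × Monomial n)

module _ {n : ℕ} where

  coeff : Poly n → Monomial n → 𝔽₂
  coeff []            m = false
  coeff ((c , u) ∷ p) m = (ifᵇ does (Vec.≡-dec ℕ._≟_ u m) then c else false) xor coeff p m

  infix 4 _≈_
  _≈_ : Poly n → Poly n → Set
  p ≈ q = ∀ m → coeff p m ≡ coeff q m

  infixl 6 _⊕_
  infixl 7 _⊗_
  infixr 8 _^_

  _⊕_ : Poly n → Poly n → Poly n
  _⊕_ = _++_

  _⊗_ : Poly n → Poly n → Poly n
  _⊗_ = cartesianProductWith (λ (c , u) (d , v) → c ∧ d , Vec.zipWith ℕ._+_ u v)

  const : 𝔽₂ → Poly n
  const c = (c , Vec.replicate n 0) ∷ []

  0ₚ 1ₚ : Poly n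
  0ₚ = []
  1ₚ = const true

  var : Fin n → Poly n
  var i = (true , Vec.replicate n 0 [ i ]≔ 1) ∷ []

  _^_ : Poly n → ℕ → Poly n
  p ^ zero  = 1ₚ
  p ^ suc k = p ⊗ p ^ k

  sumOver : {A : Set} → List A → (A → Poly n) → Poly n
  sumOver xs f = foldr _⊕_ 0ₚ (map f xs)

  vertexPoly : Fin n → Poly n
  vertexPoly i = var i ^ 3 ⊕ 1ₚ

  edgePoly : Arc n → Poly n
  edgePoly (i , j) = var i ^ 2 ⊕ var i ⊗ var j ⊕ var j ^ 2

  affine : 𝔽₂ → (Fin n → 𝔽₂) → Poly n
  affine c d = const c ⊕ sumOver (allFin n) (λ j → const (d j) ⊗ var j)

-- The coefficients b e, b′ e k are used only for e in upArcs G.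
HasDegreeOneCertificate : ∀ {n} → Graph n → Set
HasDegreeOneCertificate {n} G =
  Σ (Fin n → 𝔽₂) λ a → Σ (Fin n → Fin n → 𝔽₂) λ a′ →
  Σ (Arc n → 𝔽₂) λ b → Σ (Arc n → Fin n → 𝔽₂) λ b′ →
    sumOver (allFin n)  (λ i → affine (a i) (a′ i) ⊗ vertexPoly i)
  ⊕ sumOver (upArcs G) (λ e → affine (b e) (b′ e) ⊗ edgePoly e)
  ≈ 1ₚ

data Cycle {n} (G : Graph n) : Set where
  partial3   : ∀ i j k → Adj G i j → Adj G j k → Adj G k i → Cycle G
  chordless4 : ∀ i j k l →
               Adj G i j → Adj G j k → Adj G k l → Adj G l i →
               Propositional.Unique (i ∷ j ∷ k ∷ l ∷ []) →
               ¬ Adj G i k → ¬ Adj G j l → Cycle G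

module _ {n} {G : Graph n} where

  cycleArcs : Cycle G → List (Arc n)
  cycleArcs (partial3 i j k _ _ _)             = (i , j) ∷ (j , k) ∷ []
  cycleArcs (chordless4 i j k l _ _ _ _ _ _ _) = (i , j) ∷ (j , k) ∷ (k , l) ∷ (l , i) ∷ []

-- A cycle is its set of arcs: in particular the four rotations of
-- chordless4 i j k l are one and the same cycle.
cycleSetoid : ∀ {n} → Graph n → Setoid 0ℓ 0ℓ
cycleSetoid {n} G = On.setoid ([ set ]-Equality (Arc n)) (cycleArcs {G = G})

record CycleSet {n} (G : Graph n) : Set where
  field
    elements : List (Cycle G)
    distinct : Setoidal.Unique (cycleSetoid G) elements

-- ∣ C ∣at (i , j) is |C_(i,j)|.
∣_∣at_ : ∀ {n} {G : Graph n} → CycleSet G → Arc n → ℕ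
∣ C ∣at a = length (filter (λ c → a ∈? cycleArcs c) (CycleSet.elements C))
  where open DecMembership _≟ᵃ_ using (_∈?_)

-- The machine model is the WHILE language over binary trees of
-- N. D. Jones (Computability and Complexity from a Programming
-- Perspective), whose polynomial-time decidable problems are those of
-- Turing machines.  Every elementary operation costs one unit; sharing
-- of subtrees makes assignment and cons constant-time operations.

data Tree : Set where
  nil  : Tree
  cons : Tree → Tree → Tree

hd tl : Tree → Tree
hd nil        = nil
hd (cons s t) = s
tl nil        = nil
tl (cons s t) = t

size : Tree → ℕ
size nil        = 1
size (cons s t) = 1 ℕ.+ size s ℕ.+ size t

data Expr (r : ℕ) : Set where
  reg     : Fin r → Expr r
  nilᵉ    : Expr r
  consᵉ   : Expr r → Expr r → Expr r
  hdᵉ tlᵉ : Expr r → Expr r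

infixr 5 _⨾_
infix  6 _:=_

data Cmd (r : ℕ) : Set where
  skip          : Cmd r
  _:=_          : Fin r → Expr r → Cmd r
  _⨾_           : Cmd r → Cmd r → Cmd r
  if_then_else_ : Expr r → Cmd r → Cmd r → Cmd r
  while_loop_   : Expr r → Cmd r → Cmd r

Store : ℕ → Set
Store r = Vec Tree r

module _ {r : ℕ} where

  eval : Expr r → Store r → Tree
  eval (reg x)     σ = Vec.lookup σ x
  eval nilᵉ        σ = nil
  eval (consᵉ e f) σ = cons (eval e σ) (eval f σ)
  eval (hdᵉ e)     σ = hd (eval e σ)
  eval (tlᵉ e)     σ = tl (eval e σ)

  cost : Expr r → ℕ
  cost (reg x)     = 1
  cost nilᵉ        = 1
  cost (consᵉ e f) = 1 ℕ.+ cost e ℕ.+ cost f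
  cost (hdᵉ e)     = 1 ℕ.+ cost e
  cost (tlᵉ e)     = 1 ℕ.+ cost e

  data Truthy : Tree → Set where
    truthy : ∀ {s t} → Truthy (cons s t)

  -- ⟨ c , σ ⟩⇓ σ′ [ t ]: from store σ, c halts in store σ′ after time t.
  infix 4 ⟨_,_⟩⇓_[_]
  data ⟨_,_⟩⇓_[_] : Cmd r → Store r → Store r → ℕ → Set where
    run-skip  : ∀ {σ} → ⟨ skip , σ ⟩⇓ σ [ 1 ]
    run-:=    : ∀ {x e σ} → ⟨ x := e , σ ⟩⇓ (σ [ x ]≔ eval e σ) [ 1 ℕ.+ cost e ]
    run-⨾     : ∀ {c d σ σ′ σ″ s t} →
                ⟨ c , σ ⟩⇓ σ′ [ s ] → ⟨ d , σ′ ⟩⇓ σ″ [ t ] →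
                ⟨ c ⨾ d , σ ⟩⇓ σ″ [ s ℕ.+ t ]
    run-then  : ∀ {e c d σ σ′ t} → Truthy (eval e σ) →
                ⟨ c , σ ⟩⇓ σ′ [ t ] →
                ⟨ if e then c else d , σ ⟩⇓ σ′ [ 1 ℕ.+ cost e ℕ.+ t ]
    run-else  : ∀ {e c d σ σ′ t} → eval e σ ≡ nil →
                ⟨ d , σ ⟩⇓ σ′ [ t ] →
                ⟨ if e then c else d , σ ⟩⇓ σ′ [ 1 ℕ.+ cost e ℕ.+ t ]
    run-stop  : ∀ {e c σ} → eval e σ ≡ nil →
                ⟨ while e loop c , σ ⟩⇓ σ [ 1 ℕ.+ cost e ]
    run-while : ∀ {e c σ σ′ σ″ s t} → Truthy (eval e σ) →
                ⟨ c , σ ⟩⇓ σ′ [ s ] → ⟨ while e loop c , σ′ ⟩⇓ σ″ [ t ] →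
                ⟨ while e loop c , σ ⟩⇓ σ″ [ 1 ℕ.+ cost e ℕ.+ s ℕ.+ t ]

-- Register zero holds the input at the start and the output at the end;
-- all other registers are initially nil.
record Program : Set where
  field
    auxiliary : ℕ
    body      : Cmd (suc auxiliary)

_on_yields_within_ : Program → Tree → Tree → ℕ → Set
p on input yields output within T =
  ∃[ σ ] ∃[ t ] ⟨ body , input Vec.∷ Vec.replicate auxiliary nil ⟩⇓ σ [ t ]
              × Vec.lookup σ zero ≡ output
              × t ℕ.≤ T
  where open Program p

encodeBool : Bool → Tree
encodeBool false = nil
encodeBool true  = cons nil nil

encodeList : {A : Set} → (A → Tree) → List A → Tree
encodeList f = foldr (λ x t → cons (f x) t) nil

encodeGraph : ∀ {n} → Graph n → Tree
encodeGraph {n} G =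
  encodeList (λ i → encodeList (λ j → encodeBool (does (adj? G i j))) (allFin n)) (allFin n)

-- Sizes are at least 1, so c * s ^ d covers all polynomial bounds.
PolynomialTimeRecognizable : (∀ {n} → Graph n → Set) → Set₁
PolynomialTimeRecognizable P =
  Σ Program λ p → Σ ℕ λ c → Σ ℕ λ d →
    ∀ {n} (G : Graph n) → Σ Bool λ answer →
      p on encodeGraph G yields encodeBool answer within (c ℕ.* size (encodeGraph G) ℕ.^ d)
      × Reflects (P G) answer

{-# OPTIONS --safe #-}
-- Let y (i , j) stand for x i ^ 2 · x j modulo x i ^ 3 = 1.  In degree three the edge polynomials say
-- exactly that y (i , j) + y (j , i) = 1 on edges, that y (i , j) = y (j , k) on partial 3-cycles, and
-- that y sums to 0 along closed walks of length 4: for non-adjacent i and k every common neighbour j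
-- gives the same value y (j , i) + y (j , k) to x i ^ 2 · x k + x k ^ 2 · x i.  A solution of this linear
-- system extends to a functional on monomials that kills every left-hand side of a certificate but not
-- 1, and summing the equations of y over a set of cycles as in the theorem gives 0 = 1.  Without a
-- solution, Gaussian elimination derives 0 = 1 from the equations, each of which comes from multiples
-- of the given polynomials and is, up to edge equations, a sum of cycles.  So both sides of the
-- equivalence are decided by elimination, which runs in polynomial time; a proper colouring c gives
-- the solution y (i , j) = [c j = c i + 1].
module Submission where

open import Data.Bool.Base using (Bool; true; false; _xor_; _∧_; not) renaming (if_then_else_ to ifᵇ_then_else_)
open import Data.Bool.Properties as Bool
  using (∧-assoc; ∧-comm; ∧-zeroʳ; ∧-identityʳ; ∧-distribˡ-xor; ∧-distribʳ-xor; xor-assoc; xor-comm; xor-identityʳ;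
         xor-same; not-involutive; not-distribˡ-xor)
open import Data.Bool.Solver using (module xor-∧-Solver)
open import Data.Fin.Base as Fin using (Fin; zero; suc)
open import Data.Fin.Patterns using (0F; 1F; 2F)
import Data.Fin.Properties as Fin
open import Data.List.Base
  using (List; []; _∷_; _++_; map; length; filter; foldr; foldl; allFin; tabulate; lookup; replicate;
         cartesianProduct; concatMap; deduplicate)
open import Data.List.Membership.Propositional using (_∈_)
import Data.List.Membership.DecPropositional as DecMembership
open import Data.List.Membership.Propositional.Properties
  using (∈-map⁺; ∈-deduplicate⁺; ∈-cartesianProduct⁺; ∈-allFin; ∈-filter⁺; ∈-filter⁻)
open import Data.List.Properties
  using (++-assoc; foldr-++; foldr-map; length-++; length-map; length-tabulate; map-tabulate)
open import Data.List.Relation.Unary.All as All using (All; []; _∷_)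
import Data.List.Relation.Unary.All.Properties as All
open import Data.List.Relation.Unary.AllPairs using ([]; _∷_)
open import Data.List.Relation.Unary.Any using (here; there)
open import Data.List.Relation.Unary.Unique.DecPropositional.Properties using (deduplicate-!)
open import Data.List.Relation.Unary.Unique.Propositional using (Unique)
import Data.List.Relation.Unary.Unique.Propositional.Properties as Unique
import Data.List.Relation.Unary.Unique.Setoid as Setoidal
open import Data.Maybe.Base using (Maybe; just; nothing)
open import Data.Nat.Base as ℕ using (ℕ; zero; suc; _+_; _*_; _%_; _≤_; z≤n; s≤s; NonZero)
open import Data.Nat.ListAction using (sum)
import Data.Nat.Properties as ℕ
open import Data.Nat.Solver using (module +-*-Solver)
open import Data.Product.Base using (Σ; _×_; _,_; proj₁; proj₂; swap)
open import Data.Sum.Base using (_⊎_; inj₁; inj₂)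
open import Data.Vec.Base as Vec using (Vec; []; _∷_; _[_]≔_)
import Data.Vec.Properties as Vec
open import Function.Base using (_∘_; id; case_of_)
open import Function.Bundles using (_⇔_; mk⇔; Equivalence)
open import Relation.Binary.Bundles using (Setoid)
open import Relation.Binary.Definitions using (Decidable; DecidableEquality; Tri; tri<; tri≈; tri>)
open import Relation.Binary.PropositionalEquality
open import Relation.Nullary using (¬_; Dec; yes; no; does; contradiction; Reflects; ofʸ; ofⁿ)
open import Relation.Nullary.Decidable
  using (dec-true; dec-false; does-⇔; map′; from-yes; _×-dec_; _→-dec_; ¬?)
open import Defs renaming (sym to adj-sym; irrefl to adj-irrefl)

open xor-∧-Solver using (solve; con; _:+_) renaming (_:=_ to _≔_)

-- No certificate is turned into cycles or back: each value of `answer G` settles both sides of the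
-- equivalence, by constructing both objects from the derivation of 0 = 1 or by refuting both with
-- the solution. The obstacle is to find a functional with one value on each x i · x j · x k. Up to
-- three edges among i, j, k may prescribe that value, and the equations of y are what makes the
-- prescriptions agree. Where no edge prescribes it, a symmetric choice has to be made that respects
-- repeated variables. Degrees 1, 2 and 4 do not interact with the constant 1, so there the
-- functional may vanish. The equations are posed for all closed walks of length 4 because the
-- program can test these by adjacency alone; degenerate walks and walks with chords are decomposed
-- on the side of the cycles. The loop bound of the program is N = n + 2. Then N ^ 2 bounds both the
-- n * n columns and the lists of up to four arcs, and N ^ 6 bounds the number of rows, which is at
-- most 3 n ^ 4.

private variable
  A B X : Set
  n m N : ℕ

-- Linear algebra over 𝔽₂

xor-interchange : ∀ a b c d → (a xor b) xor (c xor d) ≡ (a xor c) xor (b xor d)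
xor-interchange = solve 4 (λ a b c d → (a :+ b) :+ (c :+ d) ≔ (a :+ c) :+ (b :+ d)) refl

xor≡false⇒≡ : ∀ a b → a xor b ≡ false → a ≡ b
xor≡false⇒≡ false false _ = refl
xor≡false⇒≡ true  true  _ = refl

⨁ : List A → (A → Bool) → Bool
⨁ []       f = false
⨁ (x ∷ xs) f = f x xor ⨁ xs f

⨁-cong∈ : ∀ (xs : List A) {f g} → (∀ {x} → x ∈ xs → f x ≡ g x) → ⨁ xs f ≡ ⨁ xs g
⨁-cong∈ []       h = refl
⨁-cong∈ (x ∷ xs) h = cong₂ _xor_ (h (here refl)) (⨁-cong∈ xs (h ∘ there))

⨁-cong : ∀ (xs : List A) {f g} → (∀ x → f x ≡ g x) → ⨁ xs f ≡ ⨁ xs g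
⨁-cong xs h = ⨁-cong∈ xs (λ {x} _ → h x)

⨁-false : ∀ (xs : List A) {f} → (∀ {x} → x ∈ xs → f x ≡ false) → ⨁ xs f ≡ false
⨁-false []       h = refl
⨁-false (x ∷ xs) h = cong₂ _xor_ (h (here refl)) (⨁-false xs (h ∘ there))

⨁-++ : ∀ (xs ys : List A) f → ⨁ (xs ++ ys) f ≡ ⨁ xs f xor ⨁ ys f
⨁-++ []       ys f = refl
⨁-++ (x ∷ xs) ys f = trans (cong (f x xor_) (⨁-++ xs ys f)) (sym (xor-assoc (f x) _ _))

⨁-xor : ∀ (xs : List A) f g → ⨁ xs (λ x → f x xor g x) ≡ ⨁ xs f xor ⨁ xs g
⨁-xor []       f g = refl
⨁-xor (x ∷ xs) f g = trans (cong ((f x xor g x) xor_) (⨁-xor xs f g)) (xor-interchange (f x) (g x) _ _)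

⨁-∧ˡ : ∀ (xs : List A) b f → ⨁ xs (λ x → b ∧ f x) ≡ b ∧ ⨁ xs f
⨁-∧ˡ []       b f = sym (∧-zeroʳ b)
⨁-∧ˡ (x ∷ xs) b f = trans (cong ((b ∧ f x) xor_) (⨁-∧ˡ xs b f)) (sym (∧-distribˡ-xor b (f x) _))

⨁-∧ʳ : ∀ (xs : List A) b f → ⨁ xs (λ x → f x ∧ b) ≡ ⨁ xs f ∧ b
⨁-∧ʳ xs b f = trans (⨁-cong xs (λ x → ∧-comm (f x) b)) (trans (⨁-∧ˡ xs b f) (∧-comm b _))

⨁-map : ∀ (g : A → B) xs f → ⨁ (map g xs) f ≡ ⨁ xs (f ∘ g)
⨁-map g []       f = refl
⨁-map g (x ∷ xs) f = cong (f (g x) xor_) (⨁-map g xs f)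

⨁-swap : ∀ (xs : List A) (ys : List B) (f : A → B → Bool) → ⨁ xs (λ x → ⨁ ys (f x)) ≡ ⨁ ys (λ y → ⨁ xs (λ x → f x y))
⨁-swap []       ys f = sym (⨁-false ys (λ _ → refl))
⨁-swap (x ∷ xs) ys f = trans (cong (⨁ ys (f x) xor_) (⨁-swap xs ys f)) (sym (⨁-xor ys (f x) _))

module _ (_≟_ : DecidableEquality A) where

  ⨁-δ : ∀ {xs a} → Unique xs → a ∈ xs → ∀ (f : A → Bool) → ⨁ xs (λ x → does (a ≟ x) ∧ f x) ≡ f a
  ⨁-δ {x ∷ xs} {a} (x∉ ∷ u) (here refl) f =
    trans (cong₂ _xor_ (cong (_∧ f a) (dec-true (a ≟ a) refl))
                       (⨁-false xs (λ {y} y∈ → cong (_∧ f y) (dec-false (a ≟ y) (All.lookup x∉ y∈)))))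
          (xor-identityʳ (f a))
  ⨁-δ {x ∷ xs} {a} (x∉ ∷ u) (there a∈) f =
    cong₂ _xor_ (cong (_∧ f x) (dec-false (a ≟ x) (λ { refl → All.lookup x∉ a∈ refl }))) (⨁-δ u a∈ f)

  -- Each `f (key x)` is expanded as a δ-sum over the distinct keys; after exchanging the sums every
  -- key has coefficient `false`. This is why a linear extension depends only on the coefficients of
  -- a formal sum.
  ⨁-collect : ∀ (xs : List B) (key : B → A) (w : B → Bool) (f : A → Bool) →
              (∀ k → ⨁ xs (λ x → w x ∧ does (key x ≟ k)) ≡ false) →
              ⨁ xs (λ x → w x ∧ f (key x)) ≡ false
  ⨁-collect xs key w f cancel = begin
    ⨁ xs (λ x → w x ∧ f (key x))
      ≡⟨ ⨁-cong∈ xs (λ {x} x∈ → cong (w x ∧_)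
           (sym (⨁-δ (deduplicate-! _≟_ keys) (∈-deduplicate⁺ _≟_ (∈-map⁺ key x∈)) f))) ⟩
    ⨁ xs (λ x → w x ∧ ⨁ ks (λ k → does (key x ≟ k) ∧ f k))
      ≡⟨ ⨁-cong xs (λ x → sym (trans (⨁-cong ks (λ k → ∧-assoc (w x) _ _)) (⨁-∧ˡ ks (w x) _))) ⟩
    ⨁ xs (λ x → ⨁ ks (λ k → (w x ∧ does (key x ≟ k)) ∧ f k))
      ≡⟨ ⨁-swap xs ks _ ⟩
    ⨁ ks (λ k → ⨁ xs (λ x → (w x ∧ does (key x ≟ k)) ∧ f k))
      ≡⟨ ⨁-false ks (λ {k} _ → trans (⨁-∧ʳ xs (f k) _) (cong (_∧ f k) (cancel k))) ⟩
    false ∎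
    where
    open ≡-Reasoning
    keys = map key xs
    ks   = deduplicate _≟_ keys

-- Gaussian elimination: either a derivation of 0 = 1 or a solution

infixl 6 _⊞_
_⊞_ : Vec Bool m → Vec Bool m → Vec Bool m
_⊞_ = Vec.zipWith _xor_

dot : Vec Bool m → Vec Bool m → Bool
dot []      []      = false
dot (a ∷ u) (b ∷ v) = (a ∧ b) xor dot u v

dot-⊞ : ∀ (y u v : Vec Bool m) → dot y (u ⊞ v) ≡ dot y u xor dot y v
dot-⊞ []      []      []      = refl
dot-⊞ (a ∷ y) (b ∷ u) (c ∷ v) =
  trans (cong₂ _xor_ (∧-distribˡ-xor a b c) (dot-⊞ y u v)) (xor-interchange (a ∧ b) (a ∧ c) _ _)

-- One round, which removes the leading variable. The first row that contains it becomes the pivot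
-- and leaves the system, since its equation only determines that variable; `nothing` means that no
-- pivot has been met yet.
eliminate : Maybe (Vec Bool m) → List (Vec Bool m) → List (Vec Bool (suc m)) → List (Vec Bool m)
eliminate p        out []                  = out
eliminate p        out ((false ∷ r) ∷ rs) = eliminate p (r ∷ out) rs
eliminate nothing  out ((true  ∷ r) ∷ rs) = eliminate (just r) out rs
eliminate (just p) out ((true  ∷ r) ∷ rs) = eliminate (just p) (r ⊞ p ∷ out) rs

anyTrue : Bool → List (Vec Bool 1) → Bool
anyTrue b []             = b
anyTrue b ((c ∷ []) ∷ rs) = anyTrue (ifᵇ c then true else b) rs

-- The last coordinate of a row is the right-hand side of its equation.
inconsistent : ∀ m → List (Vec Bool (suc m)) → Bool
inconsistent zero    rows = anyTrue false rows
inconsistent (suc m) rows = inconsistent m (eliminate nothing [] rows)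

0=1 : ∀ m → Vec Bool (suc m)
0=1 zero    = true ∷ []
0=1 (suc m) = false ∷ 0=1 m

module _ (P : Vec Bool (suc m) → Set) (⊞-closed : ∀ {u v} → P u → P v → P (u ⊞ v)) where

  eliminate-derives-just : ∀ {p out rows} → P (true ∷ p) → All (P ∘ (false ∷_)) out → All P rows →
                           All (P ∘ (false ∷_)) (eliminate (just p) out rows)
  eliminate-derives-just                            Pp os []       = os
  eliminate-derives-just {rows = (false ∷ _) ∷ _} Pp os (r ∷ rs) = eliminate-derives-just Pp (r ∷ os) rs
  eliminate-derives-just {rows = (true ∷ _) ∷ _}  Pp os (r ∷ rs) = eliminate-derives-just Pp (⊞-closed r Pp ∷ os) rs

  eliminate-derives : ∀ {out rows} → All (P ∘ (false ∷_)) out → All P rows →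
                      All (P ∘ (false ∷_)) (eliminate nothing out rows)
  eliminate-derives                            os []       = os
  eliminate-derives {rows = (false ∷ _) ∷ _} os (r ∷ rs) = eliminate-derives (r ∷ os) rs
  eliminate-derives {rows = (true ∷ _) ∷ _}  os (r ∷ rs) = eliminate-derives-just r os rs

anyTrue-derives : ∀ (P : Vec Bool 1 → Set) {b rows} → (b ≡ true → P (true ∷ [])) →
                  All P rows → anyTrue b rows ≡ true → P (true ∷ [])
anyTrue-derives P                            Pb []       eq = Pb eq
anyTrue-derives P {rows = (false ∷ []) ∷ _} Pb (r ∷ rs) eq = anyTrue-derives P Pb rs eq
anyTrue-derives P {rows = (true ∷ []) ∷ _}  Pb (r ∷ rs) eq = anyTrue-derives P (λ _ → r) rs eq

-- All rows that arise are sums of given rows. An eliminated coordinate survives as a leading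
-- `false` in the predicate, and the sum of two rows with leading `true` is again of this form.
inconsistent-derives : ∀ m (P : Vec Bool (suc m) → Set) → (∀ {u v} → P u → P v → P (u ⊞ v)) →
                       ∀ {rows} → All P rows → inconsistent m rows ≡ true → P (0=1 m)
inconsistent-derives zero    P cl rs eq = anyTrue-derives P (λ ()) rs eq
inconsistent-derives (suc m) P cl rs eq =
  inconsistent-derives m (P ∘ (false ∷_)) cl (eliminate-derives P cl [] rs) eq

-- Solutions are homogenised: when the last coordinate of y is 1, killing a row means satisfying its
-- equation, right-hand side included.
Kills : Vec Bool m → Vec Bool m → Set
Kills y r = dot y r ≡ false

-- Back substitution: the pivot equation gives the eliminated variable the value `dot y p`. A row
-- with leading `true` is then killed because its sum with the pivot is.
eliminate-solution-just : ∀ (y p : Vec Bool m) {out} rows → All (Kills y) (eliminate (just p) out rows) →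
                          All (Kills y) out × All (Kills (dot y p ∷ y)) rows
eliminate-solution-just y p []                 ks = ks , []
eliminate-solution-just y p ((false ∷ r) ∷ rs) ks with eliminate-solution-just y p rs ks
... | k ∷ os , ls = os , trans (cong (_xor dot y r) (∧-zeroʳ (dot y p))) k ∷ ls
eliminate-solution-just y p ((true ∷ r) ∷ rs)  ks with eliminate-solution-just y p rs ks
... | k ∷ os , ls = os , trans (trans (cong (_xor dot y r) (∧-identityʳ (dot y p))) (xor-comm (dot y p) (dot y r)))
                               (trans (sym (dot-⊞ y r p)) k) ∷ ls

eliminate-solution : ∀ (y : Vec Bool m) {out} rows → All (Kills y) (eliminate nothing out rows) →
                     All (Kills y) out × Σ Bool λ b → All (Kills (b ∷ y)) rows
-- Without a pivot the variable occurs in no row and is free.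
eliminate-solution y []                 ks = ks , false , []
eliminate-solution y ((false ∷ r) ∷ rs) ks with eliminate-solution y rs ks
... | k ∷ os , b , ls = os , b , trans (cong (_xor dot y r) (∧-zeroʳ b)) k ∷ ls
eliminate-solution y ((true ∷ r) ∷ rs)  ks with eliminate-solution-just y r rs ks
... | os , ls = os , dot y r , trans (cong (_xor dot y r) (∧-identityʳ (dot y r))) (xor-same (dot y r)) ∷ ls

anyTrue-false : ∀ b rows → anyTrue b rows ≡ false → b ≡ false × All (Kills (true ∷ [])) rows
anyTrue-false b []                   eq = eq , []
anyTrue-false b ((false ∷ []) ∷ rs) eq with anyTrue-false b rs eq
... | b≡ , ks = b≡ , refl ∷ ks
anyTrue-false b ((true ∷ []) ∷ rs)  eq with anyTrue-false true rs eq
... | () , _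

consistent-solution : ∀ m rows → inconsistent m rows ≡ false →
                      Σ (Vec Bool (suc m)) λ y → All (Kills y) rows × dot y (0=1 m) ≡ true
consistent-solution zero    rows eq = true ∷ [] , proj₂ (anyTrue-false false rows eq) , refl
consistent-solution (suc m) rows eq with consistent-solution m (eliminate nothing [] rows) eq
... | y , ks , y1 with eliminate-solution y rows ks
... | _ , b , ls = b ∷ y , ls , trans (cong (_xor dot y (0=1 m)) (∧-zeroʳ b)) y1

-- The linear system of a graph

-- The variables are indexed by all ordered pairs and not only by arcs, so that the number of
-- columns depends on n alone. The columns of non-arcs are zero.
pairs : ∀ n → List (Arc n)
pairs n = cartesianProduct (allFin n) (allFin n)

∈-pairs : ∀ (a : Arc n) → a ∈ pairs n
∈-pairs (i , j) = ∈-cartesianProduct⁺ (∈-allFin i) (∈-allFin j)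

-- A list of arcs is a formal sum over 𝔽₂, and this is its coefficient at a.
at : List (Arc n) → Arc n → Bool
at A a = ⨁ A (λ b → does (b ≟ᵃ a))

at-++ : ∀ (A B : List (Arc n)) a → at (A ++ B) a ≡ at A a xor at B a
at-++ A B a = ⨁-++ A B _

row : List (Arc n) → Bool → (cols : List (Arc n)) → Vec Bool (suc (length cols))
row A c []         = c ∷ []
row A c (a ∷ cols) = at A a ∷ row A c cols

row-++ : ∀ (A B : List (Arc n)) c d cols → row A c cols ⊞ row B d cols ≡ row (A ++ B) (c xor d) cols
row-++ A B c d []         = refl
row-++ A B c d (a ∷ cols) = cong₂ _∷_ (sym (at-++ A B a)) (row-++ A B c d cols)

row≡0=1 : ∀ (A : List (Arc n)) c cols → row A c cols ≡ 0=1 (length cols) →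
          c ≡ true × All (λ a → at A a ≡ false) cols
row≡0=1 A c []         refl = refl , []
row≡0=1 A c (a ∷ cols) eq   = let c≡ , as = row≡0=1 A c cols (cong Vec.tail eq) in c≡ , cong Vec.head eq ∷ as

row-[] : ∀ c (cols : List (Arc n)) y → dot y (row [] c cols) ≡ c ∧ dot y (0=1 (length cols))
row-[] false []         (b ∷ []) = cong (_xor false) (∧-zeroʳ b)
row-[] true  []         (b ∷ []) = refl
row-[] c     (a ∷ cols) (b ∷ y)  =
  trans (cong₂ _xor_ (∧-zeroʳ b) (row-[] c cols y))
        (cong (c ∧_) (cong (_xor dot y (0=1 (length cols))) (sym (∧-zeroʳ b))))

-- The variable of a is read off by pairing y with the one-term row of a. Linearity of `row` in its
-- list then replaces any bookkeeping of column positions.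
dot-row : ∀ (cols : List (Arc n)) y → dot y (0=1 (length cols)) ≡ true → ∀ A c →
          dot y (row A c cols) ≡ ⨁ A (λ a → dot y (row (a ∷ []) false cols)) xor c
dot-row cols y y1 []      c = trans (row-[] c cols y) (trans (cong (c ∧_) y1) (∧-identityʳ c))
dot-row cols y y1 (a ∷ A) c = begin
  dot y (row (a ∷ A) c cols)                      ≡⟨ cong (dot y) (row-++ (a ∷ []) A false c cols) ⟨
  dot y (row (a ∷ []) false cols ⊞ row A c cols)  ≡⟨ dot-⊞ y _ (row A c cols) ⟩
  f a xor dot y (row A c cols)                    ≡⟨ cong (f a xor_) (dot-row cols y y1 A c) ⟩
  f a xor (⨁ A f xor c)                           ≡⟨ xor-assoc (f a) (⨁ A f) c ⟨
  ⨁ (a ∷ A) f xor c                               ∎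
  where
  open ≡-Reasoning
  f = λ a → dot y (row (a ∷ []) false cols)

Quad : ℕ → Set
Quad n = Fin n × Fin n × Fin n × Fin n

quads : ∀ n → List (Quad n)
quads n = cartesianProduct (allFin n) (cartesianProduct (allFin n) (pairs n))

∈-quads : ∀ (q : Quad n) → q ∈ quads n
∈-quads (i , j , kl) = ∈-cartesianProduct⁺ (∈-allFin i) (∈-cartesianProduct⁺ (∈-allFin j) (∈-pairs kl))

-- (B , A , c) stands for the equation ∑_{a ∈ A} y a = c, imposed if all pairs in B are arcs.
Candidate : ℕ → Set
Candidate n = List (Arc n) × List (Arc n) × Bool

-- All kinds of equations share one enumeration by quadruples; an equation on fewer vertices recurs
-- for every choice of the surplus ones.
candidates : Quad n → List (Candidate n)
candidates (i , j , k , l) =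
  ((i , j) ∷ []                               , (i , j) ∷ (j , i) ∷ []                     , true)  ∷
  ((i , j) ∷ (j , k) ∷ (k , i) ∷ []           , (i , j) ∷ (j , k) ∷ []                     , false) ∷
  ((i , j) ∷ (j , k) ∷ (k , l) ∷ (l , i) ∷ [] , (i , j) ∷ (j , k) ∷ (k , l) ∷ (l , i) ∷ [] , false) ∷ []

AllAdj : Graph n → List (Arc n) → Set
AllAdj G = All (λ (i , j) → Adj G i j)

allAdj : Graph n → Bool → List (Arc n) → Bool
allAdj G b []            = b
allAdj G b ((i , j) ∷ B) = allAdj G (ifᵇ b then does (adj? G i j) else false) B

Row : ℕ → Set
Row n = Vec Bool (suc (length (pairs n)))

emit : Graph n → Candidate n → List (Row n) → List (Row n)
emit {n} G (B , A , c) rs = ifᵇ allAdj G true B then row A c (pairs n) ∷ rs else rs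

-- The directions of the folds are those of the tree program: loops over vertices descend, loops
-- over lists go forward.
rows : Graph n → List (Row n)
rows {n} G = foldr (λ q rs → foldl (λ rs x → emit G x rs) rs (candidates q)) [] (quads n)

answer : Graph n → Bool
answer {n} G = inconsistent (length (pairs n)) (rows G)

module _ (G : Graph n) where

  allAdj-sound : ∀ b B → allAdj G b B ≡ true → b ≡ true × AllAdj G B
  allAdj-sound b     []            eq = eq , []
  allAdj-sound false ((i , j) ∷ B) eq = contradiction (proj₁ (allAdj-sound false B eq)) (λ ())
  allAdj-sound true  ((i , j) ∷ B) eq with adj? G i j
  ... | yes ij = let _ , as = allAdj-sound true B eq in refl , ij ∷ as
  ... | no  _  = contradiction (proj₁ (allAdj-sound false B eq)) (λ ())

  allAdj-complete : ∀ {B} → AllAdj G B → allAdj G true B ≡ true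
  allAdj-complete []                          = refl
  allAdj-complete {(i , j) ∷ B} (ij ∷ as) rewrite dec-true (adj? G i j) ij = allAdj-complete as

  Imposed : (Row n → Set) → Candidate n → Set
  Imposed P (B , A , c) = AllAdj G B → P (row A c (pairs n))

  module _ {P : Row n → Set} where

    emit⁺ : ∀ x {rs} → Imposed P x → All P rs → All P (emit G x rs)
    emit⁺ (B , A , c) p ps with allAdj G true B in eq
    ... | true  = p (proj₂ (allAdj-sound true B eq)) ∷ ps
    ... | false = ps

    emits⁺ : ∀ xs {rs} → All (Imposed P) xs → All P rs → All P (foldl (λ rs x → emit G x rs) rs xs)
    emits⁺ []       []       rs = rs
    emits⁺ (x ∷ xs) (p ∷ ps) rs = emits⁺ xs ps (emit⁺ x p rs)

    rows⁺ : (∀ q → All (Imposed P) (candidates q)) → All P (rows G)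
    rows⁺ h = go (quads n)
      where
      go : ∀ qs → All P (foldr (λ q rs → foldl (λ rs x → emit G x rs) rs (candidates q)) [] qs)
      go []       = []
      go (q ∷ qs) = emits⁺ (candidates q) (h q) (go qs)

    emit⁻ : ∀ x {rs} → All P (emit G x rs) → Imposed P x × All P rs
    emit⁻ (B , A , c) ps with allAdj G true B in eq
    emit⁻ (B , A , c) (p ∷ ps) | true  = (λ _ → p) , ps
    emit⁻ (B , A , c) ps       | false = (λ as → contradiction (trans (sym eq) (allAdj-complete as)) (λ ())) , ps

    emits⁻ : ∀ xs {rs} → All P (foldl (λ rs x → emit G x rs) rs xs) →
             All (Imposed P) xs × All P rs
    emits⁻ []       rs = [] , rs
    emits⁻ (x ∷ xs) ps = let ps′ , rs′ = emits⁻ xs ps ; p , rs = emit⁻ x rs′ in p ∷ ps′ , rs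

    rows⁻ : All P (rows G) → ∀ q → All (Imposed P) (candidates q)
    rows⁻ ps q = go (quads n) ps (∈-quads q)
      where
      go : ∀ qs → All P (foldr (λ q rs → foldl (λ rs x → emit G x rs) rs (candidates q)) [] qs) → q ∈ qs →
           All (Imposed P) (candidates q)
      go (_  ∷ qs) ps (here refl) = proj₁ (emits⁻ (candidates q) ps)
      go (q′ ∷ qs) ps (there q∈)  = go qs (proj₂ (emits⁻ (candidates q′) ps)) q∈

  record Solution (y : Arc n → Bool) : Set where
    field
      edge : ∀ {i j} → Adj G i j → y (i , j) xor y (j , i) ≡ true
      tri  : ∀ {i j k} → Adj G i j → Adj G j k → Adj G k i → y (i , j) xor y (j , k) ≡ false
      quad : ∀ {i j k l} → Adj G i j → Adj G j k → Adj G k l → Adj G l i →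
             y (i , j) xor (y (j , k) xor (y (k , l) xor y (l , i))) ≡ false

  false⇒solution : answer G ≡ false → Σ (Arc n → Bool) Solution
  false⇒solution eq with consistent-solution _ (rows G) eq
  ... | z , ks , z1 = y , record
    -- Here and in `tri` the surplus vertices of the quadruple are filled with i.
    { edge = λ {i} {j} ij → case rows⁻ ks (i , j , i , i) of λ { (e ∷ _) → xor≡ (y (i , j)) (y (j , i)) (eqn (e (ij ∷ []))) }
    ; tri  = λ {i} {j} {k} ij jk ki → case rows⁻ ks (i , j , k , i) of λ { (_ ∷ e ∷ _) →
               xor≡ (y (i , j)) (y (j , k)) (eqn (e (ij ∷ jk ∷ ki ∷ []))) }
    ; quad = λ {i} {j} {k} {l} ij jk kl li → case rows⁻ ks (i , j , k , l) of λ { (_ ∷ _ ∷ e ∷ _) →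
               xor≡₄ (y (i , j)) (y (j , k)) (y (k , l)) (y (l , i)) (eqn (e (ij ∷ jk ∷ kl ∷ li ∷ []))) }
    }
    where
    y = λ a → dot z (row (a ∷ []) false (pairs n))
    eqn : ∀ {A c} → Kills z (row A c (pairs n)) → ⨁ A y xor c ≡ false
    eqn {A} {c} k = trans (sym (dot-row (pairs n) z z1 A c)) k
    xor≡ : ∀ a b {c} → (a xor (b xor false)) xor c ≡ false → a xor b ≡ c
    xor≡ a b {c} e = trans (cong (a xor_) (sym (xor-identityʳ b))) (xor≡false⇒≡ _ c e)
    xor≡₄ : ∀ a b c d → (a xor (b xor (c xor (d xor false)))) xor false ≡ false → a xor (b xor (c xor d)) ≡ false
    xor≡₄ a b c d e = trans (cong (λ t → a xor (b xor (c xor t))) (sym (xor-identityʳ d))) (xor≡false⇒≡ _ false e)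

  -- Elimination is run for any additive predicate on equations because it is used twice, for
  -- `CycleDerivable` and for `PolynomialDerivable`. The left-hand side of the derived equation is a
  -- list that cancels modulo 2 and need not be empty.
  true⇒derivable : (Good : List (Arc n) → Bool → Set) →
    (∀ {A B c d} → Good A c → Good B d → Good (A ++ B) (c xor d)) →
    (∀ {i j} → Adj G i j → Good ((i , j) ∷ (j , i) ∷ []) true) →
    (∀ {i j k} → Adj G i j → Adj G j k → Adj G k i → Good ((i , j) ∷ (j , k) ∷ []) false) →
    (∀ {i j k l} → Adj G i j → Adj G j k → Adj G k l → Adj G l i →
      Good ((i , j) ∷ (j , k) ∷ (k , l) ∷ (l , i) ∷ []) false) →
    answer G ≡ true → Σ (List (Arc n)) λ A → (∀ a → at A a ≡ false) × Good A true
  true⇒derivable Good add edge tri quad eq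
    with inconsistent-derives _ P
           (λ { (A , c , refl , g) (B , d , refl , h) → A ++ B , c xor d , row-++ A B c d (pairs n) , add g h })
           (rows⁺ λ q → (λ { (ij ∷ []) → _ , _ , refl , edge ij })
                      ∷ (λ { (ij ∷ jk ∷ ki ∷ []) → _ , _ , refl , tri ij jk ki })
                      ∷ (λ { (ij ∷ jk ∷ kl ∷ li ∷ []) → _ , _ , refl , quad ij jk kl li }) ∷ [])
           eq
    where
    P : Row n → Set
    P v = Σ (List (Arc n)) λ A → Σ Bool λ c → v ≡ row A c (pairs n) × Good A c
  ... | A , c , eq′ , g with row≡0=1 A c (pairs n) (sym eq′)
  ... | refl , zs = A , (λ a → All.lookup zs (∈-pairs a)) , g

  -- Every step along an edge changes the colour by +1 or -1 modulo 3. Around a triangle this forces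
  -- equal steps. Around a closed walk of length 4 the sum of the steps is even, at most 4 in
  -- absolute value and divisible by 3, hence 0, so exactly two steps are +1.
  colouring⇒solution : ThreeColorable G → Σ (Arc n → Bool) Solution
  colouring⇒solution (f , proper) = (λ (i , j) → next (f i) (f j)) , record
    { edge = λ ij → edge (f _) (f _) (proper ij)
    ; tri  = λ ij jk ki → tri (f _) (f _) (f _) (proper ij) (proper jk) (proper ki)
    ; quad = λ ij jk kl li → quad (f _) (f _) (f _) (f _) (proper ij) (proper jk) (proper kl) (proper li)
    }
    where
    next : Fin 3 → Fin 3 → Bool
    next zero             (suc zero)       = true
    next (suc zero)       (suc (suc zero)) = true
    next (suc (suc zero)) zero             = true
    next _                _                = false
    edge : ∀ a b → a ≢ b → next a b xor next b a ≡ true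
    edge = from-yes (Fin.all? λ a → Fin.all? λ b → ¬? (a Fin.≟ b) →-dec (next a b xor next b a Bool.≟ true))
    tri : ∀ a b c → a ≢ b → b ≢ c → c ≢ a → next a b xor next b c ≡ false
    tri = from-yes (Fin.all? λ a → Fin.all? λ b → Fin.all? λ c →
      ¬? (a Fin.≟ b) →-dec ¬? (b Fin.≟ c) →-dec ¬? (c Fin.≟ a) →-dec (next a b xor next b c Bool.≟ false))
    quad : ∀ a b c d → a ≢ b → b ≢ c → c ≢ d → d ≢ a → next a b xor (next b c xor (next c d xor next d a)) ≡ false
    quad = from-yes (Fin.all? λ a → Fin.all? λ b → Fin.all? λ c → Fin.all? λ d →
      ¬? (a Fin.≟ b) →-dec ¬? (b Fin.≟ c) →-dec ¬? (c Fin.≟ d) →-dec ¬? (d Fin.≟ a) →-dec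
      (next a b xor (next b c xor (next c d xor next d a)) Bool.≟ false))

-- Cycles

swap-flip : ∀ (a b : Arc n) → does (a ≟ᵃ swap b) ≡ does (swap a ≟ᵃ b)
swap-flip a b = does-⇔ (mk⇔ (cong swap) (cong swap)) (a ≟ᵃ swap b) (swap a ≟ᵃ b)

at-unique : ∀ {A : List (Arc n)} → Unique A → ∀ a → at A a ≡ does (DecMembership._∈?_ _≟ᵃ_ a A)
at-unique {A = A} u a with DecMembership._∈?_ _≟ᵃ_ a A
... | yes a∈ = trans (⨁-cong A λ b → trans (does-⇔ (mk⇔ sym sym) (b ≟ᵃ a) (a ≟ᵃ b)) (sym (∧-identityʳ _)))
                     (⨁-δ _≟ᵃ_ u a∈ (λ _ → true))
... | no a∉  = ⨁-false A (λ {b} b∈ → dec-false (b ≟ᵃ a) (λ { refl → a∉ b∈ }))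

odd : ℕ → Bool
odd zero    = false
odd (suc k) = not (odd k)

odd-+ : ∀ k l → odd (k + l) ≡ odd k xor odd l
odd-+ zero    l = refl
odd-+ (suc k) l = trans (cong not (odd-+ k l)) (not-distribˡ-xor (odd k) (odd l))

odd-length-filter : ∀ {A : Set} {P : A → Set} (P? : ∀ x → Dec (P x)) xs →
                    odd (length (filter P? xs)) ≡ ⨁ xs (does ∘ P?)
odd-length-filter P? []       = refl
odd-length-filter P? (x ∷ xs) with does (P? x)
... | true  = cong not (odd-length-filter P? xs)
... | false = odd-length-filter P? xs

odd-sum : ∀ {A : Set} (f : A → ℕ) xs → odd (sum (map f xs)) ≡ ⨁ xs (odd ∘ f)
odd-sum f []       = refl
odd-sum f (x ∷ xs) = trans (odd-+ (f x) _) (cong (odd (f x) xor_) (odd-sum f xs))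

parity : ∀ k → k % 2 ≡ 0 × odd k ≡ false ⊎ k % 2 ≡ 1 × odd k ≡ true
parity zero          = inj₁ (refl , refl)
parity (suc zero)    = inj₂ (refl , refl)
parity (suc (suc k)) with parity k
... | inj₁ (p , q) = inj₁ (p , trans (not-involutive _) q)
... | inj₂ (p , q) = inj₂ (p , trans (not-involutive _) q)

module _ {n} (G : Graph n) where

  upArcs-unique : Unique (upArcs G)
  upArcs-unique = Unique.filter⁺ _ (Unique.filter⁺ _ (Unique.cartesianProduct⁺ (Unique.allFin⁺ n) (Unique.allFin⁺ n)))

  ∈-upArcs⁺ : ∀ {i j} → Adj G i j → i Fin.< j → (i , j) ∈ upArcs G
  ∈-upArcs⁺ ij i<j = ∈-filter⁺ _ (∈-filter⁺ _ (∈-pairs _) ij) i<j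

  ∈-upArcs⁻ : ∀ {i j} → (i , j) ∈ upArcs G → Adj G i j × i Fin.< j
  ∈-upArcs⁻ a∈ = let b∈ , i<j = ∈-filter⁻ _ {xs = arcs G} a∈ in
    proj₂ (∈-filter⁻ _ {xs = pairs n} b∈) , i<j

  -- Exactly one of an arc and its reversal lies in `upArcs G`, so just one of the two δ-terms
  -- contributes, and only once.
  ⨁-upArcs-δ : ∀ {i j} → Adj G i j → ∀ (f : Arc n → Bool) →
    ⨁ (upArcs G) (λ a → does ((i , j) ≟ᵃ a) ∧ f a xor does ((i , j) ≟ᵃ swap a) ∧ f (swap a)) ≡ f (i , j)
  ⨁-upArcs-δ {i} {j} ij f with Fin.<-cmp i j
  ... | tri≈ _ i≡j _ = contradiction ij (adj-irrefl G i≡j)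
  ... | tri< i<j _ j≮i = trans (⨁-xor (upArcs G) _ _) (trans (cong₂ _xor_
          (⨁-δ _≟ᵃ_ upArcs-unique (∈-upArcs⁺ ij i<j) f)
          (⨁-false (upArcs G) (λ {a} a∈ → cong (_∧ f (swap a))
            (dec-false ((i , j) ≟ᵃ swap a) (λ { refl → j≮i (proj₂ (∈-upArcs⁻ a∈)) })))))
        (xor-identityʳ _))
  ... | tri> i≮j _ j<i = trans (⨁-xor (upArcs G) _ _) (cong₂ _xor_
          (⨁-false (upArcs G) (λ {a} a∈ → cong (_∧ f a)
            (dec-false ((i , j) ≟ᵃ a) (λ { refl → i≮j (proj₂ (∈-upArcs⁻ a∈)) }))))
          (trans (⨁-cong (upArcs G) (λ a → cong (_∧ f (swap a)) (swap-flip (i , j) a)))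
                 (⨁-δ _≟ᵃ_ upArcs-unique (∈-upArcs⁺ (adj-sym G ij) j<i) (f ∘ swap))))

  ⨁-by-edges : ∀ {A} → AllAdj G A → ∀ (f : Arc n → Bool) →
    ⨁ A f ≡ ⨁ (upArcs G) (λ a → at A a ∧ f a xor at A (swap a) ∧ f (swap a))
  ⨁-by-edges {A} adj f = begin
    ⨁ A f
      ≡⟨ ⨁-cong∈ A (λ {b} b∈ → sym (⨁-upArcs-δ (All.lookup adj b∈) f)) ⟩
    ⨁ A (λ b → ⨁ (upArcs G) (λ a → does (b ≟ᵃ a) ∧ f a xor does (b ≟ᵃ swap a) ∧ f (swap a)))
      ≡⟨ ⨁-swap A (upArcs G) _ ⟩
    ⨁ (upArcs G) (λ a → ⨁ A (λ b → does (b ≟ᵃ a) ∧ f a xor does (b ≟ᵃ swap a) ∧ f (swap a)))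
      ≡⟨ ⨁-cong (upArcs G) (λ a → trans (⨁-xor A _ _) (cong₂ _xor_ (⨁-∧ʳ A (f a) _) (⨁-∧ʳ A (f (swap a)) _))) ⟩
    ⨁ (upArcs G) (λ a → at A a ∧ f a xor at A (swap a) ∧ f (swap a)) ∎
    where open ≡-Reasoning

  cycleArcs-adj : ∀ (c : Cycle G) → AllAdj G (cycleArcs c)
  cycleArcs-adj (partial3 i j k ij jk _)                = ij ∷ jk ∷ []
  cycleArcs-adj (chordless4 i j k l ij jk kl li _ _ _)  = ij ∷ jk ∷ kl ∷ li ∷ []

  -- This identifies membership in a cycle, which `∣_∣at_` counts, with multiplicity modulo 2, which
  -- is additive. In a chordless 4-cycle already the sources of the arcs are distinct.
  cycleArcs-unique : ∀ (c : Cycle G) → Unique (cycleArcs c)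
  cycleArcs-unique (partial3 i j k ij _ _)            = ((λ { refl → adj-irrefl G refl ij }) ∷ []) ∷ [] ∷ []
  cycleArcs-unique (chordless4 i j k l _ _ _ _ u _ _) = Unique.map⁻ {f = proj₁} u

  through : List (Cycle G) → Arc n → Bool
  through C = at (concatMap cycleArcs C)

  ∣∣-odd : ∀ (C : CycleSet G) a → odd (∣ C ∣at a) ≡ through (CycleSet.elements C) a
  ∣∣-odd C a = trans (odd-length-filter (λ c → DecMembership._∈?_ _≟ᵃ_ a (cycleArcs c)) (CycleSet.elements C))
                     (go (CycleSet.elements C))
    where
    go : ∀ cs → ⨁ cs (λ c → does (DecMembership._∈?_ _≟ᵃ_ a (cycleArcs c))) ≡ through cs a
    go []       = refl
    go (c ∷ cs) = trans (cong₂ _xor_ (sym (at-unique (cycleArcs-unique c) a)) (go cs))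
                        (sym (at-++ (cycleArcs c) (concatMap cycleArcs cs) a))

  odd-edge : ∀ (C : CycleSet G) i j → odd (∣ C ∣at (i , j) + ∣ C ∣at (j , i)) ≡
             through (CycleSet.elements C) (i , j) xor through (CycleSet.elements C) (j , i)
  odd-edge C i j = trans (odd-+ (∣ C ∣at (i , j)) (∣ C ∣at (j , i))) (cong₂ _xor_ (∣∣-odd C (i , j)) (∣∣-odd C (j , i)))

  odd-total : ∀ (C : CycleSet G) → odd (sum (map (λ a → ∣ C ∣at a) (upArcs G))) ≡ ⨁ (upArcs G) (through (CycleSet.elements C))
  odd-total C = trans (odd-sum (λ a → ∣ C ∣at a) (upArcs G)) (⨁-cong (upArcs G) (∣∣-odd C))

  CycleCondition : CycleSet G → Set
  CycleCondition C = (∀ (i j : Fin n) → Adj G i j → (∣ C ∣at (i , j) + ∣ C ∣at (j , i)) % 2 ≡ 0)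
                     × sum (map (λ a → ∣ C ∣at a) (upArcs G)) % 2 ≡ 1

  -- The two conditions of the theorem modulo 2, for any function on arcs and any total, which makes
  -- them additive.
  record Balanced (h : Arc n → Bool) (c : Bool) : Set where
    constructor balanced
    field
      even  : ∀ {i j} → Adj G i j → h (i , j) xor h (j , i) ≡ false
      total : ⨁ (upArcs G) h ≡ c

  condition⇒balanced : ∀ C → CycleCondition C → Balanced (through (CycleSet.elements C)) true
  condition⇒balanced C (c₁ , c₂) = balanced
    (λ {i} {j} ij → trans (sym (odd-edge C i j)) (even (∣ C ∣at (i , j) + ∣ C ∣at (j , i)) (c₁ i j ij)))
    (trans (sym (odd-total C)) (uneven (sum (map (λ a → ∣ C ∣at a) (upArcs G))) c₂))
    where
    even : ∀ k → k % 2 ≡ 0 → odd k ≡ false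
    even k e with parity k
    ... | inj₁ (_ , q) = q
    ... | inj₂ (p , _) = contradiction (trans (sym p) e) (λ ())
    uneven : ∀ k → k % 2 ≡ 1 → odd k ≡ true
    uneven k e with parity k
    ... | inj₁ (p , _) = contradiction (trans (sym p) e) (λ ())
    ... | inj₂ (_ , q) = q

  balanced⇒condition : ∀ C → Balanced (through (CycleSet.elements C)) true → CycleCondition C
  balanced⇒condition C (balanced even total) =
    (λ i j ij → %-even (∣ C ∣at (i , j) + ∣ C ∣at (j , i)) (trans (odd-edge C i j) (even ij))) ,
    %-odd (sum (map (λ a → ∣ C ∣at a) (upArcs G))) (trans (odd-total C) total)
    where
    %-even : ∀ k → odd k ≡ false → k % 2 ≡ 0
    %-even k e with parity k
    ... | inj₁ (p , _) = p
    ... | inj₂ (_ , q) = contradiction (trans (sym q) e) (λ ())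
    %-odd : ∀ k → odd k ≡ true → k % 2 ≡ 1
    %-odd k e with parity k
    ... | inj₁ (_ , q) = contradiction (trans (sym q) e) (λ ())
    ... | inj₂ (p , _) = p

  concat-adj : ∀ (C : List (Cycle G)) → AllAdj G (concatMap cycleArcs C)
  concat-adj []      = []
  concat-adj (c ∷ C) = All.++⁺ (cycleArcs-adj c) (concat-adj C)

  -- Summing the equations of y over C counts every edge |C_(i,j)| ≡ |C_(j,i)| times.
  solution⇒¬balanced : ∀ {y} → Solution G y → ∀ C → ¬ Balanced (through C) true
  solution⇒¬balanced {y} sol C (balanced even total) = contradiction (trans (sym zero-sum) one-sum) (λ ())
    where
    open Solution sol
    vanish : ∀ c → ⨁ (cycleArcs {G = G} c) y ≡ false
    vanish (partial3 i j k ij jk ki) = trans (cong (y (i , j) xor_) (xor-identityʳ _)) (tri ij jk ki)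
    vanish (chordless4 i j k l ij jk kl li _ _ _) =
      trans (cong (λ t → y (i , j) xor (y (j , k) xor (y (k , l) xor t))) (xor-identityʳ _)) (quad ij jk kl li)
    zero-sum : ⨁ (concatMap cycleArcs C) y ≡ false
    zero-sum = go C
      where
      go : ∀ cs → ⨁ (concatMap cycleArcs cs) y ≡ false
      go []       = refl
      go (c ∷ cs) = trans (⨁-++ (cycleArcs c) _ y) (cong₂ _xor_ (vanish c) (go cs))
    collect : ∀ s t u v → s xor t ≡ false → u xor v ≡ true → s ∧ u xor t ∧ v ≡ s
    collect false false u     v     _ _  = refl
    collect true  true  false v     _ e = e
    collect true  true  true  false _ _ = refl
    one-sum : ⨁ (concatMap cycleArcs C) y ≡ true
    one-sum = trans (⨁-by-edges (concat-adj C) y) (trans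
      (⨁-cong∈ (upArcs G) (λ {a} a∈ → let ij , _ = ∈-upArcs⁻ a∈ in
        collect (through C a) (through C (swap a)) (y a) (y (swap a)) (even ij) (edge ij)))
      total)

  -- From lists of cycles to sets of cycles

  open Setoid (cycleSetoid G) using () renaming (_≈_ to _≋_)

  _≋?_ : Decidable _≋_
  c ≋? d = map′ (λ (p , q) → mk⇔ (All.lookup p) (All.lookup q))
                (λ e → All.tabulate (Equivalence.to e) , All.tabulate (Equivalence.from e))
                (All.all? (λ a → DecMembership._∈?_ _≟ᵃ_ a (cycleArcs d)) (cycleArcs c)
                 ×-dec All.all? (λ a → DecMembership._∈?_ _≟ᵃ_ a (cycleArcs c)) (cycleArcs d))

  at-cong-≋ : ∀ {c d} → c ≋ d → ∀ a → at (cycleArcs c) a ≡ at (cycleArcs d) a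
  at-cong-≋ {c} {d} e a = begin
    at (cycleArcs c) a                                  ≡⟨ at-unique (cycleArcs-unique c) a ⟩
    does (DecMembership._∈?_ _≟ᵃ_ a (cycleArcs c))      ≡⟨ does-⇔ e (DecMembership._∈?_ _≟ᵃ_ a (cycleArcs c)) (DecMembership._∈?_ _≟ᵃ_ a (cycleArcs d)) ⟩
    does (DecMembership._∈?_ _≟ᵃ_ a (cycleArcs d))      ≡⟨ at-unique (cycleArcs-unique d) a ⟨
    at (cycleArcs d) a                                  ∎
    where open ≡-Reasoning

  -- Symmetric difference with a singleton: two cycles with the same arcs cancel modulo 2, so
  -- repeated toggling turns a list into a set without changing any parity.
  toggle : Cycle G → List (Cycle G) → List (Cycle G)
  toggle c []       = c ∷ []
  toggle c (d ∷ ds) with c ≋? d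
  ... | yes _ = ds
  ... | no  _ = d ∷ toggle c ds

  toggle-All : ∀ {P : Cycle G → Set} {c ds} → P c → All P ds → All P (toggle c ds)
  toggle-All                     p []       = p ∷ []
  toggle-All {c = c} {ds = d ∷ _} p (q ∷ qs) with c ≋? d
  ... | yes _ = qs
  ... | no  _ = q ∷ toggle-All p qs

  toggle-unique : ∀ {c ds} → Setoidal.Unique (cycleSetoid G) ds → Setoidal.Unique (cycleSetoid G) (toggle c ds)
  toggle-unique                  []       = [] ∷ []
  toggle-unique {c} {d ∷ ds} (d∉ ∷ u) with c ≋? d
  ... | yes _   = u
  ... | no  c≉d = toggle-All (λ d≋c → c≉d (Setoid.sym (cycleSetoid G) {d} {c} d≋c)) d∉ ∷ toggle-unique u

  toggle-through : ∀ c ds a → through (toggle c ds) a ≡ at (cycleArcs c) a xor through ds a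
  toggle-through c []       a = at-++ (cycleArcs c) [] a
  toggle-through c (d ∷ ds) a with c ≋? d
  ... | yes e = sym (begin
    at (cycleArcs c) a xor through (d ∷ ds) a
      ≡⟨ cong₂ _xor_ (at-cong-≋ {c} {d} e a) (at-++ (cycleArcs d) (concatMap cycleArcs ds) a) ⟩
    at (cycleArcs d) a xor (at (cycleArcs d) a xor through ds a)
      ≡⟨ xor-assoc (at (cycleArcs d) a) _ _ ⟨
    (at (cycleArcs d) a xor at (cycleArcs d) a) xor through ds a
      ≡⟨ cong (_xor through ds a) (xor-same (at (cycleArcs d) a)) ⟩
    through ds a ∎)
    where open ≡-Reasoning
  ... | no _ = begin
    through (d ∷ toggle c ds) a
      ≡⟨ at-++ (cycleArcs d) _ a ⟩
    at (cycleArcs d) a xor through (toggle c ds) a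
      ≡⟨ cong (at (cycleArcs d) a xor_) (toggle-through c ds a) ⟩
    at (cycleArcs d) a xor (at (cycleArcs c) a xor through ds a)
      ≡⟨ exchange (at (cycleArcs d) a) (at (cycleArcs c) a) _ ⟩
    at (cycleArcs c) a xor (at (cycleArcs d) a xor through ds a)
      ≡⟨ cong (at (cycleArcs c) a xor_) (at-++ (cycleArcs d) _ a) ⟨
    at (cycleArcs c) a xor through (d ∷ ds) a ∎
    where
    open ≡-Reasoning
    exchange : ∀ p q r → p xor (q xor r) ≡ q xor (p xor r)
    exchange = solve 3 (λ p q r → p :+ (q :+ r) ≔ q :+ (p :+ r)) refl

  reduce : ∀ cs → Σ (CycleSet G) λ C → ∀ a → through (CycleSet.elements C) a ≡ through cs a
  reduce []       = record { elements = [] ; distinct = [] } , λ _ → refl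
  reduce (c ∷ cs) = let C , e = reduce cs in
    record { elements = toggle c (CycleSet.elements C) ; distinct = toggle-unique (CycleSet.distinct C) } ,
    λ a → trans (toggle-through c (CycleSet.elements C) a)
                (trans (cong (at (cycleArcs c) a xor_) (e a)) (sym (at-++ (cycleArcs c) _ a)))

  Balanced-cong : ∀ {h h′ c} → (∀ a → h a ≡ h′ a) → Balanced h c → Balanced h′ c
  Balanced-cong e (balanced even total) = balanced
    (λ ij → trans (sym (cong₂ _xor_ (e _) (e _))) (even ij))
    (trans (⨁-cong (upArcs G) (λ a → sym (e a))) total)

  Balanced-xor : ∀ {h h′ c c′} → Balanced h c → Balanced h′ c′ → Balanced (λ a → h a xor h′ a) (c xor c′)
  Balanced-xor {h} {h′} (balanced e t) (balanced e′ t′) = balanced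
    (λ {i} {j} ij → trans (xor-interchange (h (i , j)) (h′ (i , j)) (h (j , i)) (h′ (j , i))) (cong₂ _xor_ (e ij) (e′ ij)))
    (trans (⨁-xor (upArcs G) h h′) (cong₂ _xor_ t t′))

  -- An equation that becomes a combination of edge equations after adding cycles.
  record CycleDerivable (A : List (Arc n)) (c : Bool) : Set where
    constructor _,_
    field
      cycles       : List (Cycle G)
      cancellation : Balanced (λ a → at A a xor through cycles a) c

  CD-cong : ∀ {A B c} → (∀ a → at A a ≡ at B a) → CycleDerivable A c → CycleDerivable B c
  CD-cong e (C , b) = C , Balanced-cong (λ a → cong (_xor through C a) (e a)) b

  CD-++ : ∀ {A B c d} → CycleDerivable A c → CycleDerivable B d → CycleDerivable (A ++ B) (c xor d)
  CD-++ {A} {B} (C , b) (D , b′) = C ++ D , Balanced-cong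
    (λ a → trans (xor-interchange (at A a) (through C a) (at B a) (through D a))
      (sym (cong₂ _xor_ (at-++ A B a)
        (trans (cong (λ t → at t a) (concatMap-++ C D)) (at-++ (concatMap cycleArcs C) _ a)))))
    (Balanced-xor b b′)
    where
    concatMap-++ : ∀ cs ds → concatMap cycleArcs (cs ++ ds) ≡ concatMap (cycleArcs {G = G}) cs ++ concatMap cycleArcs ds
    concatMap-++ []       ds = refl
    concatMap-++ (c ∷ cs) ds = trans (cong (cycleArcs c ++_) (concatMap-++ cs ds)) (sym (++-assoc (cycleArcs c) _ _))

  CD-cycle : ∀ c → CycleDerivable (cycleArcs c) false
  CD-cycle c = c ∷ [] , Balanced-cong
    (λ a → sym (trans (cong (at (cycleArcs c) a xor_) (trans (at-++ (cycleArcs c) [] a) (xor-identityʳ _)))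
                      (xor-same (at (cycleArcs c) a))))
    (balanced (λ _ → refl) (⨁-false (upArcs G) (λ _ → refl)))

  -- Both orientations have coefficient 1, and exactly one of them enters the total; hence the
  -- right-hand side `true` without any cycle.
  CD-edge : ∀ {i j} → Adj G i j → CycleDerivable ((i , j) ∷ (j , i) ∷ []) true
  CD-edge {i} {j} ij = [] , Balanced-cong (λ a → sym (trans (xor-identityʳ _) (cong (δ a xor_) (xor-identityʳ _))))
    (balanced
      (λ {k} {l} _ → both k l)
      (trans (⨁-cong (upArcs G) (λ a → cong₂ _xor_ (sym (∧-identityʳ (δ a)))
               (trans (sym (swap-flip (i , j) a)) (sym (∧-identityʳ (δ (swap a)))))))
             (⨁-upArcs-δ ij (λ _ → true))))
    where
    δ : Arc n → Bool
    δ a = does ((i , j) ≟ᵃ a)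
    both : ∀ k l → (δ (k , l) xor does ((j , i) ≟ᵃ (k , l))) xor (δ (l , k) xor does ((j , i) ≟ᵃ (l , k))) ≡ false
    both k l rewrite sym (swap-flip (i , j) (k , l)) | sym (swap-flip (i , j) (l , k)) =
      trans (cong ((δ (k , l) xor δ (l , k)) xor_) (xor-comm (δ (l , k)) _)) (xor-same (δ (k , l) xor δ (l , k)))

  -- A partial 3-cycle carries only two arcs of its triangle, so a chord splits the walk into two
  -- partial 3-cycles in which the chord itself does not appear. A walk that turns back, with i = k
  -- or j = l, consists of two edges in both orientations, and 1 + 1 = 0. What remains is chordless
  -- with distinct vertices.
  CD-quad : ∀ {i j k l} → Adj G i j → Adj G j k → Adj G k l → Adj G l i →
            CycleDerivable ((i , j) ∷ (j , k) ∷ (k , l) ∷ (l , i) ∷ []) false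
  CD-quad {i} {j} {k} {l} ij jk kl li with i Fin.≟ k | j Fin.≟ l | adj? G i k | adj? G j l
  ... | yes refl | _ | _ | _ = CD-++ (CD-edge ij) (CD-edge (adj-sym G li))
  ... | no _ | yes refl | _ | _ = CD-cong {A = (i , j) ∷ (j , i) ∷ (j , k) ∷ (k , j) ∷ []} (λ a →
      rotate (does ((i , j) ≟ᵃ a)) (does ((j , i) ≟ᵃ a)) (does ((j , k) ≟ᵃ a)) (does ((k , j) ≟ᵃ a)))
      (CD-++ (CD-edge ij) (CD-edge jk))
    where
    rotate : ∀ p q r s → p xor (q xor (r xor (s xor false))) ≡ p xor (r xor (s xor (q xor false)))
    rotate = solve 4 (λ p q r s → p :+ (q :+ (r :+ (s :+ con false))) ≔ p :+ (r :+ (s :+ (q :+ con false)))) refl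
  ... | no _ | no _ | yes ik | _ =
      CD-++ (CD-cycle (partial3 i j k ij jk (adj-sym G ik))) (CD-cycle (partial3 k l i kl li ik))
  ... | no _ | no _ | no _ | yes jl = CD-cong {A = (j , k) ∷ (k , l) ∷ (l , i) ∷ (i , j) ∷ []} (λ a →
      rotate (does ((j , k) ≟ᵃ a)) (does ((k , l) ≟ᵃ a)) (does ((l , i) ≟ᵃ a)) (does ((i , j) ≟ᵃ a)))
      (CD-++ (CD-cycle (partial3 j k l jk kl (adj-sym G jl))) (CD-cycle (partial3 l i j li ij jl)))
    where
    rotate : ∀ p q r s → p xor (q xor (r xor (s xor false))) ≡ s xor (p xor (q xor (r xor false)))
    rotate = solve 4 (λ p q r s → p :+ (q :+ (r :+ (s :+ con false))) ≔ s :+ (p :+ (q :+ (r :+ con false)))) refl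
  ... | no i≢k | no j≢l | no ¬ik | no ¬jl = CD-cycle (chordless4 i j k l ij jk kl li
      ((≢ ij ∷ i≢k ∷ (λ e → ≢ li (sym e)) ∷ []) ∷ (≢ jk ∷ j≢l ∷ []) ∷ (≢ kl ∷ []) ∷ [] ∷ []) ¬ik ¬jl)
    where
    ≢ : ∀ {a b} → Adj G a b → a ≢ b
    ≢ ab e = adj-irrefl G e ab

  true⇒cycles : answer G ≡ true → Σ (CycleSet G) CycleCondition
  true⇒cycles eq with true⇒derivable G CycleDerivable CD-++ CD-edge (λ ij jk ki → CD-cycle (partial3 _ _ _ ij jk ki)) CD-quad eq
  -- The formal sum `A` vanishes, so the cycles alone are balanced with total 1.
  ... | A , at≡false , C , b = let D , e = reduce C in
    D , balanced⇒condition D (Balanced-cong (λ a → trans (cong (_xor through C a) (at≡false a)) (sym (e a))) b)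

  solution⇒¬cycles : ∀ {y} → Solution G y → ¬ Σ (CycleSet G) CycleCondition
  solution⇒¬cycles sol (C , cond) = solution⇒¬balanced sol (CycleSet.elements C) (condition⇒balanced C cond)

-- Certificates

infixl 6 _+ᵐ_
_+ᵐ_ : Monomial n → Monomial n → Monomial n
_+ᵐ_ = Vec.zipWith _+_

0ᵐ : Monomial n
0ᵐ = Vec.replicate _ 0

xᵐ : Fin n → Monomial n
xᵐ i = 0ᵐ [ i ]≔ 1

+ᵐ-identityˡ : ∀ (u : Monomial n) → 0ᵐ +ᵐ u ≡ u
+ᵐ-identityˡ = Vec.zipWith-identityˡ ℕ.+-identityˡ

+ᵐ-identityʳ : ∀ (u : Monomial n) → u +ᵐ 0ᵐ ≡ u
+ᵐ-identityʳ = Vec.zipWith-identityʳ ℕ.+-identityʳ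

+ᵐ-comm : ∀ (u v : Monomial n) → u +ᵐ v ≡ v +ᵐ u
+ᵐ-comm = Vec.zipWith-comm ℕ.+-comm

+ᵐ-exchange : ∀ (u v w : Monomial n) → u +ᵐ (v +ᵐ w) ≡ v +ᵐ (u +ᵐ w)
+ᵐ-exchange u v w = trans (sym (Vec.zipWith-assoc ℕ.+-assoc u v w))
  (trans (cong (_+ᵐ w) (+ᵐ-comm u v)) (Vec.zipWith-assoc ℕ.+-assoc v u w))

-- The linear extension of L. Coefficients are the case of an indicator function, so polynomials are
-- compared by pairing them with all L, and identities between them become identities in 𝔽₂.
ext : (Monomial n → Bool) → Poly n → Bool
ext L p = ⨁ p (λ (c , u) → c ∧ L u)

coeff-ext : ∀ (p : Poly n) m → coeff p m ≡ ext (λ u → does (Vec.≡-dec ℕ._≟_ u m)) p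
coeff-ext []            m = refl
coeff-ext ((c , u) ∷ p) m = cong₂ _xor_ (if-true (does (Vec.≡-dec ℕ._≟_ u m)) c) (coeff-ext p m)
  where
  if-true : ∀ b c → (ifᵇ b then c else false) ≡ c ∧ b
  if-true false c = sym (∧-zeroʳ c)
  if-true true  c = sym (∧-identityʳ c)

ext-cong-≈ : ∀ (L : Monomial n → Bool) p q → p ≈ q → ext L p ≡ ext L q
ext-cong-≈ L p q p≈q = xor≡false⇒≡ _ _ (trans (sym (⨁-++ p q _))
  (⨁-collect (Vec.≡-dec ℕ._≟_) (p ++ q) proj₂ proj₁ L λ m →
    trans (⨁-++ p q _) (trans (cong₂ _xor_ (sym (coeff-ext p m)) (sym (coeff-ext q m)))
      (trans (cong (_xor coeff q m) (p≈q m)) (xor-same (coeff q m))))))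

ext-⊗ : ∀ (L : Monomial n → Bool) p q → ext L (p ⊗ q) ≡ ext (λ u → ext (λ v → L (u +ᵐ v)) q) p
ext-⊗ L []            q = refl
ext-⊗ L ((c , u) ∷ p) q = trans (⨁-++ (map _ q) (p ⊗ q) _) (cong₂ _xor_
  (trans (⨁-map _ q _) (trans (⨁-cong q (λ (d , v) → ∧-assoc c d _)) (⨁-∧ˡ q c _)))
  (ext-⊗ L p q))

ext-sumOver : ∀ (L : Monomial n → Bool) {A : Set} (xs : List A) f → ext L (sumOver xs f) ≡ ⨁ xs (ext L ∘ f)
ext-sumOver L []       f = refl
ext-sumOver L (x ∷ xs) f = trans (⨁-++ (f x) _ _) (cong (ext L (f x) xor_) (ext-sumOver L xs f))

ext-affine : ∀ (L : Monomial n → Bool) c d → ext L (affine c d) ≡ c ∧ L 0ᵐ xor ⨁ (allFin n) (λ j → d j ∧ L (xᵐ j))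
ext-affine {n} L c d = cong ((c ∧ L 0ᵐ) xor_) (trans (ext-sumOver L (allFin n) (λ j → const (d j) ⊗ var j))
  (⨁-cong (allFin n) (λ j → trans (xor-identityʳ ((d j ∧ true) ∧ L (0ᵐ +ᵐ xᵐ j)))
                                  (cong₂ _∧_ (∧-identityʳ (d j)) (cong L (+ᵐ-identityˡ (xᵐ j)))))))

cubic : (Monomial n → Bool) → Fin n → Fin n → Fin n → Bool
cubic L i j k = L (xᵐ i +ᵐ (xᵐ j +ᵐ xᵐ k))

cubic-swap₁₂ : ∀ (L : Monomial n → Bool) i j k → cubic L i j k ≡ cubic L j i k
cubic-swap₁₂ L i j k = cong L (+ᵐ-exchange (xᵐ i) (xᵐ j) (xᵐ k))

cubic-swap₂₃ : ∀ (L : Monomial n → Bool) i j k → cubic L i j k ≡ cubic L i k j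
cubic-swap₂₃ L i j k = cong (λ u → L (xᵐ i +ᵐ u)) (+ᵐ-comm (xᵐ j) (xᵐ k))

shift : (Monomial n → Bool) → Monomial n → Poly n → Bool
shift L u q = ext (λ v → L (u +ᵐ v)) q

shift-vertex : ∀ (L : Monomial n → Bool) i → shift L 0ᵐ (vertexPoly i) ≡ cubic L i i i xor L 0ᵐ
shift-vertex L i = cong₂ (λ u b → L u xor b)
  (trans (+ᵐ-identityˡ _) (cong (λ w → xᵐ i +ᵐ (xᵐ i +ᵐ w)) (+ᵐ-identityʳ (xᵐ i))))
  (trans (xor-identityʳ _) (cong L (+ᵐ-identityˡ 0ᵐ)))

shift-edge : ∀ (L : Monomial n → Bool) k i j →
             shift L (xᵐ k) (edgePoly (i , j)) ≡ cubic L k i i xor (cubic L k i j xor cubic L k j j)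
shift-edge L k i j = cong₂ (λ b c → b xor (cubic L k i j xor c))
  (cong (λ w → L (xᵐ k +ᵐ (xᵐ i +ᵐ w))) (+ᵐ-identityʳ (xᵐ i)))
  (trans (xor-identityʳ _) (cong (λ w → L (xᵐ k +ᵐ (xᵐ j +ᵐ w))) (+ᵐ-identityʳ (xᵐ j))))

module _ {n} (G : Graph n) where

  combination : (Fin n → Bool) → (Fin n → Fin n → Bool) → (Arc n → Bool) → (Arc n → Fin n → Bool) → Poly n
  combination a a′ b b′ = sumOver (allFin n) (λ i → affine (a i) (a′ i) ⊗ vertexPoly i)
                        ⊕ sumOver (upArcs G) (λ e → affine (b e) (b′ e) ⊗ edgePoly e)

  ext-combination : ∀ L a a′ b b′ → ext L (combination a a′ b b′) ≡
    ⨁ (allFin n) (λ i → a i ∧ shift L 0ᵐ (vertexPoly i) xor ⨁ (allFin n) (λ j → a′ i j ∧ shift L (xᵐ j) (vertexPoly i)))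
    xor ⨁ (upArcs G) (λ e → b e ∧ shift L 0ᵐ (edgePoly e) xor ⨁ (allFin n) (λ k → b′ e k ∧ shift L (xᵐ k) (edgePoly e)))
  ext-combination L a a′ b b′ = trans
    (⨁-++ (sumOver (allFin n) (λ i → affine (a i) (a′ i) ⊗ vertexPoly i)) _ (λ (c , u) → c ∧ L u))
    (cong₂ _xor_
      (trans (ext-sumOver L (allFin n) (λ i → affine (a i) (a′ i) ⊗ vertexPoly i)) (⨁-cong (allFin n) (λ i →
        trans (ext-⊗ L (affine (a i) (a′ i)) (vertexPoly i))
              (ext-affine (λ u → shift L u (vertexPoly i)) (a i) (a′ i)))))
      (trans (ext-sumOver L (upArcs G) (λ e → affine (b e) (b′ e) ⊗ edgePoly e)) (⨁-cong (upArcs G) (λ e →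
        trans (ext-⊗ L (affine (b e) (b′ e)) (edgePoly e))
              (ext-affine (λ u → shift L u (edgePoly e)) (b e) (b′ e))))))

  -- The polynomial p is given by its pairing with the functionals on monomials.
  record Generated (p : (Monomial n → Bool) → Bool) : Set where
    constructor generated
    field
      α       : Fin n → Bool
      β       : Arc n → Fin n → Bool
      pairing : ∀ L → ⨁ (allFin n) (λ i → α i ∧ (cubic L i i i xor L 0ᵐ))
                      xor ⨁ (upArcs G) (λ e → ⨁ (allFin n) (λ k → β e k ∧ shift L (xᵐ k) (edgePoly e)))
                      ≡ p L

  generated-cong : ∀ {p q} → (∀ L → p L ≡ q L) → Generated p → Generated q
  generated-cong p≗q (generated α β e) = generated α β (λ L → trans (e L) (p≗q L))

  generated-xor : ∀ {p q} → Generated p → Generated q → Generated (λ L → p L xor q L)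
  generated-xor (generated α β e) (generated α′ β′ e′) = generated (λ i → α i xor α′ i) (λ a k → β a k xor β′ a k) λ L →
    trans (cong₂ _xor_
      (trans (⨁-cong (allFin n) (λ i → ∧-distribʳ-xor _ (α i) (α′ i))) (⨁-xor (allFin n) _ _))
      (trans (⨁-cong (upArcs G) (λ a → trans (⨁-cong (allFin n) (λ k → ∧-distribʳ-xor _ (β a k) (β′ a k))) (⨁-xor (allFin n) _ _)))
             (⨁-xor (upArcs G) _ _)))
    (trans (xor-interchange (⨁ (allFin n) _) _ _ _) (cong₂ _xor_ (e L) (e′ L)))

  generated-vertex : ∀ i → Generated (λ L → cubic L i i i xor L 0ᵐ)
  generated-vertex i = generated (λ j → does (i Fin.≟ j)) (λ _ _ → false) λ L →
    trans (cong₂ _xor_ (⨁-δ Fin._≟_ (Unique.allFin⁺ n) (∈-allFin i) (λ j → cubic L j j j xor L 0ᵐ))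
      (⨁-false (upArcs G) (λ _ → ⨁-false (allFin n) (λ _ → refl))))
    (xor-identityʳ _)

  generated-upArc : ∀ {i j} k → Adj G i j → i Fin.< j →
                    Generated (λ L → cubic L k i i xor (cubic L k i j xor cubic L k j j))
  generated-upArc {i} {j} k ij i<j = generated (λ _ → false) (λ a l → does ((i , j) ≟ᵃ a) ∧ does (k Fin.≟ l)) λ L →
    trans (cong₂ _xor_ (⨁-false (allFin n) (λ _ → refl)) (trans
      (⨁-cong (upArcs G) (λ a → trans
        (⨁-cong (allFin n) (λ l → ∧-assoc (does ((i , j) ≟ᵃ a)) (does (k Fin.≟ l)) _))
        (trans (⨁-∧ˡ (allFin n) (does ((i , j) ≟ᵃ a)) _)
               (cong (does ((i , j) ≟ᵃ a) ∧_) (⨁-δ Fin._≟_ (Unique.allFin⁺ n) (∈-allFin k) (λ l → shift L (xᵐ l) (edgePoly a)))))))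
      (⨁-δ _≟ᵃ_ (upArcs-unique G) (∈-upArcs⁺ G ij i<j) (λ a → shift L (xᵐ k) (edgePoly a)))))
    (shift-edge L k i j)

  generated-arc : ∀ {i j} k → Adj G i j → Generated (λ L → cubic L k i i xor (cubic L k i j xor cubic L k j j))
  generated-arc {i} {j} k ij with Fin.<-cmp i j
  ... | tri< i<j _ _ = generated-upArc k ij i<j
  ... | tri≈ _ i≡j _ = contradiction ij (adj-irrefl G i≡j)
  ... | tri> _ _ j<i = generated-cong
    (λ L → trans (cong (λ t → cubic L k j j xor (t xor cubic L k i i)) (cubic-swap₂₃ L k j i))
                 (rev (cubic L k j j) (cubic L k i j) (cubic L k i i)))
    (generated-upArc k (adj-sym G ij) j<i)
    where
    rev : ∀ a b c → a xor (b xor c) ≡ c xor (b xor a)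
    rev = solve 3 (λ a b c → a :+ (b :+ c) ≔ c :+ (b :+ a)) refl

  -- The arc (i , j) stands for the monomial x i ^ 2 · x j.
  square : (Monomial n → Bool) → Arc n → Bool
  square L (i , j) = cubic L i i j

  -- The equation is read as the polynomial ∑ x i ^ 2 · x j + c, with the sum over the arcs in A.
  record PolynomialDerivable (A : List (Arc n)) (c : Bool) : Set where
    constructor derivable
    field derivation : Generated (λ L → ⨁ A (square L) xor (c ∧ L 0ᵐ))

  PD-++ : ∀ {A B c d} → PolynomialDerivable A c → PolynomialDerivable B d → PolynomialDerivable (A ++ B) (c xor d)
  PD-++ {A} {B} {c} {d} (derivable g) (derivable h) = derivable (generated-cong
    (λ L → trans (xor-interchange (⨁ A (square L)) (c ∧ L 0ᵐ) (⨁ B (square L)) (d ∧ L 0ᵐ))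
                 (sym (cong₂ _xor_ (⨁-++ A B (square L)) (∧-distribʳ-xor (L 0ᵐ) c d))))
    (generated-xor g h))

  -- x i · (x i ^ 2 + x i · x j + x j ^ 2) + (x i ^ 3 + 1): the cubes cancel.
  generated-edge : ∀ {i j} → Adj G i j → Generated (λ L → square L (i , j) xor (square L (j , i) xor L 0ᵐ))
  generated-edge {i} {j} ij = generated-cong
    (λ L → trans (cong (λ t → (cubic L i i i xor (cubic L i i j xor t)) xor (cubic L i i i xor L 0ᵐ))
                       (trans (cubic-swap₁₂ L i j j) (cubic-swap₂₃ L j i j)))
                 (cancel (cubic L i i i) (cubic L i i j) (cubic L j j i) (L 0ᵐ)))
    (generated-xor (generated-arc i ij) (generated-vertex i))
    where
    cancel : ∀ a b c d → (a xor (b xor c)) xor (a xor d) ≡ b xor (c xor d)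
    cancel = solve 4 (λ a b c d → (a :+ (b :+ c)) :+ (a :+ d) ≔ b :+ (c :+ d)) refl

  -- x k times the polynomial of {i, j} plus x i times that of {j, k}: the mixed monomial x i · x j
  -- · x k cancels.
  generated-path : ∀ {i j k} → Adj G i j → Adj G j k →
    Generated (λ L → (square L (i , k) xor square L (k , i)) xor (square L (j , k) xor square L (j , i)))
  generated-path {i} {j} {k} ij jk = generated-cong
    (λ L → trans
      (cong₂ _xor_
        (cong₂ _xor_ (rotate L k i) (cong₂ _xor_ (trans (cubic-swap₁₂ L k i j) (cubic-swap₂₃ L i k j)) (rotate L k j)))
        (cong (λ t → t xor (cubic L i j k xor cubic L i k k)) (rotate L i j)))
      (trans (cong (λ t → (cubic L i i k xor (cubic L i j k xor cubic L j j k)) xor (cubic L j j i xor (cubic L i j k xor t))) (rotate L i k))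
      (cancel (cubic L i i k) (cubic L i j k) (cubic L j j k) (cubic L j j i) (cubic L k k i))))
    (generated-xor (generated-arc k ij) (generated-arc i jk))
    where
    rotate : ∀ L a b → cubic L a b b ≡ cubic L b b a
    rotate L a b = trans (cubic-swap₁₂ L a b b) (cubic-swap₂₃ L b a b)
    cancel : ∀ a b c d e → (a xor (b xor c)) xor (d xor (b xor e)) ≡ (a xor e) xor (c xor d)
    cancel = solve 5 (λ a b c d e → (a :+ (b :+ c)) :+ (d :+ (b :+ e)) ≔ (a :+ e) :+ (c :+ d)) refl

  PD-edge : ∀ {i j} → Adj G i j → PolynomialDerivable ((i , j) ∷ (j , i) ∷ []) true
  PD-edge {i} {j} ij = derivable (generated-cong
    (λ L → regroup (square L (i , j)) (square L (j , i)) (L 0ᵐ)) (generated-edge ij))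
    where
    regroup : ∀ a b c → a xor (b xor c) ≡ (a xor (b xor false)) xor c
    regroup = solve 3 (λ a b c → a :+ (b :+ c) ≔ (a :+ (b :+ con false)) :+ c) refl

  -- Adding the edge relations of {i, k} and {i, j} to the path relation of i, j, k cancels
  -- everything about {i, k}, both constants and the arc (j , i).
  PD-tri : ∀ {i j k} → Adj G i j → Adj G j k → Adj G k i → PolynomialDerivable ((i , j) ∷ (j , k) ∷ []) false
  PD-tri {i} {j} {k} ij jk ki = derivable (generated-cong
    (λ L → cancel (square L (i , k)) (square L (k , i)) (square L (j , k)) (square L (j , i)) (square L (i , j)) (L 0ᵐ))
    (generated-xor (generated-path ij jk) (generated-xor (generated-edge (adj-sym G ki)) (generated-edge ij))))
    where
    cancel : ∀ a b c d e o → ((a xor b) xor (c xor d)) xor ((a xor (b xor o)) xor (e xor (d xor o))) ≡ (e xor (c xor false)) xor false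
    cancel = solve 6 (λ a b c d e o → ((a :+ b) :+ (c :+ d)) :+ ((a :+ (b :+ o)) :+ (e :+ (d :+ o))) ≔ (e :+ (c :+ con false)) :+ con false) refl

  -- The paths from i to k through j and through l have the same part in x i and x k, which cancels
  -- in their sum. The edge relations of {i, j} and {k, l} then reverse two arcs so that all follow
  -- the walk.
  PD-quad : ∀ {i j k l} → Adj G i j → Adj G j k → Adj G k l → Adj G l i →
            PolynomialDerivable ((i , j) ∷ (j , k) ∷ (k , l) ∷ (l , i) ∷ []) false
  PD-quad {i} {j} {k} {l} ij jk kl li = derivable (generated-cong
    (λ L → collect (square L (j , k)) (square L (j , i)) (square L (l , k)) (square L (l , i))
                   (square L (i , j)) (square L (k , l)) (L 0ᵐ))
    (generated-xor
      (generated-cong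
        (λ L → cancel (square L (i , k)) (square L (k , i)) (square L (j , k) xor square L (j , i))
                      (square L (l , k) xor square L (l , i)))
        (generated-xor (generated-path ij jk) (generated-path (adj-sym G li) (adj-sym G kl))))
      (generated-xor (generated-edge ij) (generated-edge kl))))
    where
    cancel : ∀ p q a b → ((p xor q) xor a) xor ((p xor q) xor b) ≡ a xor b
    cancel = solve 4 (λ p q a b → ((p :+ q) :+ a) :+ ((p :+ q) :+ b) ≔ a :+ b) refl
    collect : ∀ a b c d e f o →
      ((a xor b) xor (c xor d)) xor ((e xor (b xor o)) xor (f xor (c xor o)))
      ≡ (e xor (a xor (f xor (d xor false)))) xor false
    collect = solve 7 (λ a b c d e f o →
      ((a :+ b) :+ (c :+ d)) :+ ((e :+ (b :+ o)) :+ (f :+ (c :+ o)))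
      ≔ (e :+ (a :+ (f :+ (d :+ con false)))) :+ con false) refl

  cubicCombination : (Fin n → Bool) → (Arc n → Fin n → Bool) → Poly n
  cubicCombination α β = combination α (λ _ _ → false) (λ _ → false) β

  ext-cubicCombination : ∀ L α β → ext L (cubicCombination α β) ≡
    ⨁ (allFin n) (λ i → α i ∧ (cubic L i i i xor L 0ᵐ))
    xor ⨁ (upArcs G) (λ e → ⨁ (allFin n) (λ k → β e k ∧ shift L (xᵐ k) (edgePoly e)))
  ext-cubicCombination L α β = trans (ext-combination L α (λ _ _ → false) (λ _ → false) β)
    (cong (_xor ⨁ (upArcs G) (λ e → ⨁ (allFin n) (λ k → β e k ∧ shift L (xᵐ k) (edgePoly e))))
      (⨁-cong (allFin n) (λ i → begin
        (α i ∧ shift L 0ᵐ (vertexPoly i)) xor ⨁ (allFin n) (λ _ → false)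
          ≡⟨ cong ((α i ∧ shift L 0ᵐ (vertexPoly i)) xor_) (⨁-false (allFin n) (λ _ → refl)) ⟩
        (α i ∧ shift L 0ᵐ (vertexPoly i)) xor false
          ≡⟨ xor-identityʳ (α i ∧ shift L 0ᵐ (vertexPoly i)) ⟩
        α i ∧ shift L 0ᵐ (vertexPoly i)
          ≡⟨ cong (α i ∧_) (shift-vertex L i) ⟩
        α i ∧ (cubic L i i i xor L 0ᵐ) ∎)))
    where open ≡-Reasoning

  coeff-cubicCombination : ∀ {A} → (∀ a → at A a ≡ false) → (d : PolynomialDerivable A true) →
    let open Generated (PolynomialDerivable.derivation d) in cubicCombination α β ≈ 1ₚ
  coeff-cubicCombination {A} at≡false (derivable (generated α β pairing)) m = begin
    coeff (cubicCombination α β) m   ≡⟨ coeff-ext (cubicCombination α β) m ⟩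
    ext L (cubicCombination α β)     ≡⟨ ext-cubicCombination L α β ⟩
    ⨁ (allFin n) (λ i → α i ∧ (cubic L i i i xor L 0ᵐ))
      xor ⨁ (upArcs G) (λ e → ⨁ (allFin n) (λ k → β e k ∧ shift L (xᵐ k) (edgePoly e)))
                                     ≡⟨ pairing L ⟩
    ⨁ A (square L) xor L 0ᵐ          ≡⟨ cong (_xor L 0ᵐ) (⨁-collect _≟ᵃ_ A (λ a → a) (λ _ → true) (square L) at≡false) ⟩
    L 0ᵐ                             ≡⟨ xor-identityʳ (L 0ᵐ) ⟨
    ext L 1ₚ                         ≡⟨ coeff-ext 1ₚ m ⟨
    coeff 1ₚ m                       ∎
    where
    open ≡-Reasoning
    -- The coefficient functional at m.
    L = λ u → does (Vec.≡-dec ℕ._≟_ u m)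

  true⇒certificate : answer G ≡ true → HasDegreeOneCertificate G
  true⇒certificate eq =
    let A , at≡false , d = true⇒derivable G PolynomialDerivable PD-++ PD-edge PD-tri PD-quad eq
        open Generated (PolynomialDerivable.derivation d)
    in α , (λ _ _ → false) , (λ _ → false) , β , coeff-cubicCombination at≡false d

-- A solution of the system gives a functional that refutes all certificates

infixr 5 _⊴_
-- A Boolean order that computes on `suc`, so that `insert` commutes with the shift of variables in
-- `factors`.
_⊴_ : Fin n → Fin n → Bool
zero  ⊴ _     = true
suc i ⊴ zero  = false
suc i ⊴ suc j = i ⊴ j

insert : Fin n → List (Fin n) → List (Fin n)
insert i []       = i ∷ []
insert i (j ∷ js) = ifᵇ i ⊴ j then i ∷ j ∷ js else j ∷ insert i js

-- The sorted list of variables with multiplicity. It exposes the degree and lets a function of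
-- three vertices act on cubic monomials.
factors : Monomial n → List (Fin n)
factors []      = []
factors (c ∷ u) = replicate c zero ++ map suc (factors u)

factors-0 : ∀ n → factors (0ᵐ {n}) ≡ []
factors-0 zero    = refl
factors-0 (suc n) = cong (map suc) (factors-0 n)

insert-suc : ∀ (i : Fin n) c js → insert (suc i) (replicate c zero ++ map suc js) ≡ replicate c zero ++ map suc (insert i js)
insert-suc i zero    []       = refl
insert-suc i zero    (j ∷ js) with i ⊴ j
... | true  = refl
... | false = cong (suc j ∷_) (insert-suc i zero js)
insert-suc i (suc c) js       = cong (zero ∷_) (insert-suc i c js)

factors-x : ∀ (i : Fin n) u → factors (xᵐ i +ᵐ u) ≡ insert i (factors u)
factors-x zero    (c ∷ u) = trans (cong (λ v → zero ∷ replicate c zero ++ map suc (factors v)) (+ᵐ-identityˡ u)) (sym (insert-zero _))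
  where
  insert-zero : ∀ (js : List (Fin (suc n))) → insert zero js ≡ zero ∷ js
  insert-zero []       = refl
  insert-zero (j ∷ js) = refl
factors-x (suc i) (c ∷ u) = trans (cong (λ js → replicate c zero ++ map suc js) (factors-x i u)) (sym (insert-suc i c (factors u)))

factors-x₁ : ∀ (i : Fin n) → factors (xᵐ i) ≡ i ∷ []
factors-x₁ i = trans (cong factors (sym (+ᵐ-identityʳ (xᵐ i)))) (trans (factors-x i 0ᵐ) (cong (insert i) (factors-0 _)))

length-insert : ∀ (i : Fin n) js → length (insert i js) ≡ suc (length js)
length-insert i []       = refl
length-insert i (j ∷ js) with i ⊴ j
... | true  = refl
... | false = cong suc (length-insert i js)

-- The functional that is 1 on the monomial 1 and T i j k on x i · x j · x k, and 0 in all other degrees.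
module Functional (T : Fin n → Fin n → Fin n → Bool)
                  (T-swap₁₂ : ∀ i j k → T i j k ≡ T j i k) (T-swap₂₃ : ∀ i j k → T i j k ≡ T i k j) where

  onFactors : List (Fin n) → Bool
  onFactors []               = true
  onFactors (i ∷ j ∷ k ∷ []) = T i j k
  onFactors _                = false

  Λ : Monomial n → Bool
  Λ u = onFactors (factors u)

  -- Sorting permutes the three variables, and the two transpositions under which T is invariant
  -- generate all permutations.
  onFactors-insert : ∀ i j k → onFactors (insert i (insert j (k ∷ []))) ≡ T i j k
  onFactors-insert i j k with j ⊴ k
  onFactors-insert i j k | true with i ⊴ j
  onFactors-insert i j k | true | true = refl
  onFactors-insert i j k | true | false with i ⊴ k
  ... | true  = T-swap₁₂ j i k
  ... | false = trans (T-swap₂₃ j k i) (T-swap₁₂ j i k)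
  onFactors-insert i j k | false with i ⊴ k
  onFactors-insert i j k | false | true = T-swap₂₃ i k j
  onFactors-insert i j k | false | false with i ⊴ j
  ... | true  = trans (T-swap₁₂ k i j) (T-swap₂₃ i k j)
  ... | false = trans (T-swap₂₃ k j i) (trans (T-swap₁₂ k i j) (T-swap₂₃ i k j))

  Λ-cubic : ∀ i j k → cubic Λ i j k ≡ T i j k
  Λ-cubic i j k = trans (cong onFactors (trans (factors-x i (xᵐ j +ᵐ xᵐ k)) (cong (insert i)
    (trans (factors-x j (xᵐ k)) (cong (insert j) (factors-x₁ k)))))) (onFactors-insert i j k)

  onFactors-2 : ∀ js → length js ≡ 2 → onFactors js ≡ false
  onFactors-2 (_ ∷ _ ∷ []) _ = refl

  onFactors-4 : ∀ js → length js ≡ 4 → onFactors js ≡ false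
  onFactors-4 (_ ∷ _ ∷ _ ∷ _ ∷ []) _ = refl

  degree : Monomial n → ℕ
  degree u = length (factors u)

  degree-x : ∀ i u → degree (xᵐ i +ᵐ u) ≡ suc (degree u)
  degree-x i u = trans (cong length (factors-x i u)) (length-insert i (factors u))

  degree-x₁ : ∀ i → degree (xᵐ i) ≡ 1
  degree-x₁ i = cong length (factors-x₁ i)

  Λ-0 : Λ 0ᵐ ≡ true
  Λ-0 = cong onFactors (factors-0 _)

  Λ-1 : ∀ i → Λ (xᵐ i) ≡ false
  Λ-1 i = cong onFactors (factors-x₁ i)

  Λ-2 : ∀ i j → Λ (xᵐ i +ᵐ xᵐ j) ≡ false
  Λ-2 i j = onFactors-2 (factors (xᵐ i +ᵐ xᵐ j)) (trans (degree-x i (xᵐ j)) (cong suc (degree-x₁ j)))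

  Λ-4 : ∀ i j k l → Λ (xᵐ i +ᵐ (xᵐ j +ᵐ (xᵐ k +ᵐ xᵐ l))) ≡ false
  Λ-4 i j k l = onFactors-4 (factors (xᵐ i +ᵐ (xᵐ j +ᵐ (xᵐ k +ᵐ xᵐ l))))
    (trans (degree-x i _) (cong suc (trans (degree-x j _) (cong suc (trans (degree-x k _) (cong suc (degree-x₁ l)))))))

  Λ-vertex : (∀ i → T i i i ≡ true) → ∀ i → shift Λ 0ᵐ (vertexPoly i) ≡ false
  Λ-vertex Tiii i = trans (shift-vertex Λ i) (cong₂ _xor_ (trans (Λ-cubic i i i) (Tiii i)) Λ-0)

  Λ-x·vertex : ∀ i j → shift Λ (xᵐ j) (vertexPoly i) ≡ false
  Λ-x·vertex i j = cong₂ _xor_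
    (trans (cong (λ u → Λ (xᵐ j +ᵐ (xᵐ i +ᵐ (xᵐ i +ᵐ u)))) (+ᵐ-identityʳ (xᵐ i))) (Λ-4 j i i i))
    (trans (xor-identityʳ _) (trans (cong Λ (+ᵐ-identityʳ (xᵐ j))) (Λ-1 j)))

  Λ-edge : ∀ i j → shift Λ 0ᵐ (edgePoly (i , j)) ≡ false
  Λ-edge i j = cong₂ _xor_ (at-xx i) (cong₂ _xor_ (trans (cong Λ (+ᵐ-identityˡ (xᵐ i +ᵐ xᵐ j))) (Λ-2 i j))
                                                   (cong (_xor false) (at-xx j)))
    where
    at-xx : ∀ i → Λ (0ᵐ +ᵐ (xᵐ i +ᵐ (xᵐ i +ᵐ 0ᵐ))) ≡ false
    at-xx i = trans (cong Λ (trans (+ᵐ-identityˡ _) (cong (xᵐ i +ᵐ_) (+ᵐ-identityʳ (xᵐ i))))) (Λ-2 i i)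

  Λ-x·edge : ∀ k i j → T k i i xor (T k i j xor T k j j) ≡ false → shift Λ (xᵐ k) (edgePoly (i , j)) ≡ false
  Λ-x·edge k i j eq = trans (shift-edge Λ k i j)
    (trans (cong₂ _xor_ (Λ-cubic k i i) (cong₂ _xor_ (Λ-cubic k i j) (Λ-cubic k j j))) eq)

  module _ (G : Graph n) (Tiii : ∀ i → T i i i ≡ true)
           (T-edge : ∀ {i j} k → Adj G i j → T k i i xor (T k i j xor T k j j) ≡ false) where

    ¬certificate : ¬ HasDegreeOneCertificate G
    ¬certificate (a , a′ , b , b′ , eq) = contradiction (begin
      false                               ≡⟨ cong₂ _xor_
        (⨁-false (allFin n) (λ {i} _ → cong₂ _xor_ (∧-false (a i) (Λ-vertex Tiii i))
          (⨁-false (allFin n) (λ {j} _ → ∧-false (a′ i j) (Λ-x·vertex i j)))))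
        (⨁-false (upArcs G) (λ {e} e∈ → cong₂ _xor_ (∧-false (b e) (Λ-edge (proj₁ e) (proj₂ e)))
          (⨁-false (allFin n) (λ {k} _ → ∧-false (b′ e k)
            (Λ-x·edge k (proj₁ e) (proj₂ e) (T-edge k (proj₁ (∈-upArcs⁻ G e∈)))))))) ⟨
      _                                   ≡⟨ ext-combination G Λ a a′ b b′ ⟨
      ext Λ (combination G a a′ b b′)     ≡⟨ ext-cong-≈ Λ (combination G a a′ b b′) 1ₚ eq ⟩
      ext Λ 1ₚ                            ≡⟨ cong (_xor false) Λ-0 ⟩
      true                                ∎) (λ ())
      where
      open ≡-Reasoning
      ∧-false : ∀ c {d} → d ≡ false → c ∧ d ≡ false
      ∧-false c refl = ∧-zeroʳ c

module _ {n} (G : Graph n) {y : Arc n → Bool} (sol : Solution G y) where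
  open Solution sol

  -- Any common neighbour may be taken. Without one, no triple containing i and k has two edges to
  -- reconcile, so the default is harmless.
  detour : ∀ i k → Dec (Σ (Fin n) λ j → Adj G i j × Adj G j k) → Bool
  detour i k (yes (j , _)) = y (j , i) xor y (j , k)
  detour i k (no _)        = false

  -- z i k is the value of x i ^ 2 · x k.  For non-adjacent i and k only z i k + z k i is determined,
  -- namely by any common neighbour.
  z : Fin n → Fin n → Bool
  z i k = ifᵇ does (i Fin.≟ k) then true else
          ifᵇ does (adj? G i k) then y (i , k) else
          -- Only the ascending pair carries the prescribed sum; the descending pair gets `false`.
          ifᵇ does (i Fin.<? k) then detour i k (Fin.any? (λ j → adj? G i j ×-dec adj? G j k)) else false

  z-refl : ∀ i → z i i ≡ true
  z-refl i rewrite dec-true (i Fin.≟ i) refl = refl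

  z-adj : ∀ {i k} → Adj G i k → z i k ≡ y (i , k)
  z-adj {i} {k} ik rewrite dec-false (i Fin.≟ k) (λ e → adj-irrefl G e ik) | dec-true (adj? G i k) ik = refl

  solve-edge : ∀ {i j} → Adj G i j → y (i , j) ≡ not (y (j , i))
  solve-edge {i} {j} ij = go (y (i , j)) (y (j , i)) (edge ij)
    where
    go : ∀ a b → a xor b ≡ true → a ≡ not b
    go true  false _ = refl
    go false true  _ = refl

  -- The search may return a neighbour l other than j. The equation of the closed walk i, j, k, l
  -- says that both give the same value.
  z-< : ∀ {i j k} → Adj G i j → Adj G j k → ¬ Adj G i k → i Fin.< k → z i k xor z k i ≡ y (j , i) xor y (j , k)
  z-< {i} {j} {k} ij jk ¬ik i<k
    rewrite dec-false (i Fin.≟ k) (Fin.<⇒≢ i<k) | dec-false (adj? G i k) ¬ik | dec-true (i Fin.<? k) i<k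
          | dec-false (k Fin.≟ i) (λ e → Fin.<⇒≢ i<k (sym e)) | dec-false (adj? G k i) (λ ki → ¬ik (adj-sym G ki))
          | dec-false (k Fin.<? i) (Fin.<-asym i<k)
    with Fin.any? (λ j → adj? G i j ×-dec adj? G j k)
  ... | no ∄                = contradiction (j , ij , jk) ∄
  ... | yes (l , il , lk)   = go (y (l , i)) (y (l , k)) (y (j , i)) (y (j , k)) (begin
    not (y (j , i)) xor (y (j , k) xor (not (y (l , k)) xor y (l , i)))
      ≡⟨ cong₂ (λ s t → s xor (y (j , k) xor (t xor y (l , i)))) (solve-edge ij) (solve-edge (adj-sym G lk)) ⟨
    y (i , j) xor (y (j , k) xor (y (k , l) xor y (l , i)))
      ≡⟨ quad ij jk (adj-sym G lk) (adj-sym G il) ⟩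
    false ∎)
    where
    open ≡-Reasoning
    go : ∀ a b c d → not c xor (d xor (not b xor a)) ≡ false → (a xor b) xor false ≡ c xor d
    go true  true  true  true  _ = refl
    go true  true  false false _ = refl
    go true  false true  false _ = refl
    go true  false false true  _ = refl
    go false true  true  false _ = refl
    go false true  false true  _ = refl
    go false false true  true  _ = refl
    go false false false false _ = refl

  -- If i and k are adjacent, the left side is 1 by the edge equation and the right side is 1
  -- because y (i , j) = y (j , k). If i = k, both sides vanish. Otherwise `z` was chosen for this
  -- purpose.
  z-path : ∀ {i j k} → Adj G i j → Adj G j k → z i k xor z k i ≡ y (j , i) xor y (j , k)
  z-path {i} {j} {k} ij jk = by (adj? G i k) (Fin.<-cmp i k)
    where
    go : ∀ a b → not a xor b ≡ false → true ≡ a xor b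
    go true  false _ = refl
    go false true  _ = refl
    by : Dec (Adj G i k) → Tri (i Fin.< k) (i ≡ k) (k Fin.< i) → z i k xor z k i ≡ y (j , i) xor y (j , k)
    by (yes ik) _ = trans (cong₂ _xor_ (z-adj ik) (z-adj (adj-sym G ik))) (trans (edge ik)
      (go (y (j , i)) (y (j , k)) (trans (cong (_xor y (j , k)) (sym (solve-edge ij))) (tri ij jk (adj-sym G ik)))))
    by (no _)   (tri≈ _ refl _) = trans (xor-same (z i i)) (sym (xor-same (y (j , i))))
    by (no ¬ik) (tri< i<k _ _)  = z-< ij jk ¬ik i<k
    by (no ¬ik) (tri> _ _ k<i)  = trans (xor-comm (z i k) (z k i))
      (trans (z-< (adj-sym G jk) (adj-sym G ij) (λ ki → ¬ik (adj-sym G ki)) k<i) (xor-comm (y (j , k)) _))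

  -- The value of x i · x j · x k forced by the edge {i, j}.
  viaEdge : Fin n → Fin n → Fin n → Bool
  viaEdge i j k = z i k xor z j k

  viaEdge-swap : ∀ i j k → viaEdge i j k ≡ viaEdge j i k
  viaEdge-swap i j k = xor-comm (z i k) (z j k)

  -- A rearrangement of `z-path`: two edges in a triple prescribe the same value.
  viaEdge-rotate : ∀ {i j k} → Adj G i j → Adj G j k → viaEdge i j k ≡ viaEdge j k i
  viaEdge-rotate {i} {j} {k} ij jk = go (z i k) (z j k) (z j i) (z k i)
    (trans (z-path ij jk) (sym (cong₂ _xor_ (z-adj (adj-sym G ij)) (z-adj jk))))
    where
    go : ∀ a b c d → a xor d ≡ c xor b → a xor b ≡ c xor d
    go a b c d e = begin
      a xor b                   ≡⟨ regroup₁ a b d ⟩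
      (a xor d) xor (b xor d)   ≡⟨ cong (_xor (b xor d)) e ⟩
      (c xor b) xor (b xor d)   ≡⟨ regroup₂ b c d ⟩
      c xor d                   ∎
      where
      open ≡-Reasoning
      regroup₁ : ∀ a b d → a xor b ≡ (a xor d) xor (b xor d)
      regroup₁ = solve 3 (λ a b d → a :+ b ≔ (a :+ d) :+ (b :+ d)) refl
      regroup₂ : ∀ b c d → (c xor b) xor (b xor d) ≡ c xor d
      regroup₂ = solve 3 (λ b c d → (c :+ b) :+ (b :+ d) ≔ c :+ d) refl

  -- With a repeated vertex the monomial is a square times a variable, whose value is given by `z`.
  -- On three distinct vertices no edge imposes anything.
  edgeless : Fin n → Fin n → Fin n → Bool
  edgeless i j k = ifᵇ does (i Fin.≟ j) then z i k else
                   ifᵇ does (j Fin.≟ k) then z j i else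
                   ifᵇ does (k Fin.≟ i) then z k j else false

  triple : Fin n → Fin n → Fin n → Bool
  triple i j k = ifᵇ does (adj? G i j) then viaEdge i j k else
                 ifᵇ does (adj? G j k) then viaEdge j k i else
                 ifᵇ does (adj? G k i) then viaEdge k i j else edgeless i j k

  triple-ij : ∀ {i j} k → Adj G i j → triple i j k ≡ viaEdge i j k
  triple-ij {i} {j} k ij rewrite dec-true (adj? G i j) ij = refl

  triple-jk : ∀ i {j k} → Adj G j k → triple i j k ≡ viaEdge j k i
  triple-jk i {j} {k} jk = by (adj? G i j)
    where
    by : Dec (Adj G i j) → triple i j k ≡ viaEdge j k i
    by (yes ij) = trans (triple-ij k ij) (viaEdge-rotate ij jk)
    by (no ¬ij) rewrite dec-false (adj? G i j) ¬ij | dec-true (adj? G j k) jk = refl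

  triple-ki : ∀ {i} j {k} → Adj G k i → triple i j k ≡ viaEdge k i j
  triple-ki {i} j {k} ki = by (adj? G i j) (adj? G j k)
    where
    by : Dec (Adj G i j) → Dec (Adj G j k) → triple i j k ≡ viaEdge k i j
    by (yes ij) _        = trans (triple-ij k ij) (sym (viaEdge-rotate ki ij))
    by (no _)   (yes jk) = trans (triple-jk i jk) (viaEdge-rotate jk ki)
    by (no ¬ij) (no ¬jk) rewrite dec-false (adj? G i j) ¬ij | dec-false (adj? G j k) ¬jk | dec-true (adj? G k i) ki = refl

  triple-none : ∀ {i j k} → ¬ Adj G i j → ¬ Adj G j k → ¬ Adj G k i → triple i j k ≡ edgeless i j k
  triple-none {i} {j} {k} ¬ij ¬jk ¬ki
    rewrite dec-false (adj? G i j) ¬ij | dec-false (adj? G j k) ¬jk | dec-false (adj? G k i) ¬ki = refl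

  edgeless-ij : ∀ i k → edgeless i i k ≡ z i k
  edgeless-ij i k rewrite dec-true (i Fin.≟ i) refl = refl

  edgeless-jk : ∀ i j → edgeless i j j ≡ z j i
  edgeless-jk i j = by (i Fin.≟ j)
    where
    by : Dec (i ≡ j) → edgeless i j j ≡ z j i
    by (yes refl) = edgeless-ij i i
    by (no i≢j) rewrite dec-false (i Fin.≟ j) i≢j | dec-true (j Fin.≟ j) refl = refl

  edgeless-ki : ∀ i j → edgeless i j i ≡ z i j
  edgeless-ki i j = by (i Fin.≟ j)
    where
    by : Dec (i ≡ j) → edgeless i j i ≡ z i j
    by (yes refl) = edgeless-ij i i
    by (no i≢j) rewrite dec-false (i Fin.≟ j) i≢j | dec-false (j Fin.≟ i) (≢-sym i≢j) | dec-true (i Fin.≟ i) refl = refl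

  edgeless-none : ∀ {i j k} → i ≢ j → j ≢ k → k ≢ i → edgeless i j k ≡ false
  edgeless-none {i} {j} {k} i≢j j≢k k≢i
    rewrite dec-false (i Fin.≟ j) i≢j | dec-false (j Fin.≟ k) j≢k | dec-false (k Fin.≟ i) k≢i = refl

  edgeless-swap₁₂ : ∀ i j k → edgeless i j k ≡ edgeless j i k
  edgeless-swap₁₂ i j k = by (i Fin.≟ j) (j Fin.≟ k) (k Fin.≟ i)
    where
    by : Dec (i ≡ j) → Dec (j ≡ k) → Dec (k ≡ i) → edgeless i j k ≡ edgeless j i k
    by (yes refl) _ _                = refl
    by (no _) (yes refl) _           = trans (edgeless-jk i j) (sym (edgeless-ki j i))
    by (no _) (no _) (yes refl)      = trans (edgeless-ki i j) (sym (edgeless-jk j i))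
    by (no i≢j) (no j≢k) (no k≢i)    = trans (edgeless-none i≢j j≢k k≢i) (sym (edgeless-none (≢-sym i≢j) (≢-sym k≢i) (≢-sym j≢k)))

  edgeless-swap₂₃ : ∀ i j k → edgeless i j k ≡ edgeless i k j
  edgeless-swap₂₃ i j k = by (i Fin.≟ j) (j Fin.≟ k) (k Fin.≟ i)
    where
    by : Dec (i ≡ j) → Dec (j ≡ k) → Dec (k ≡ i) → edgeless i j k ≡ edgeless i k j
    by (yes refl) _ _                = trans (edgeless-ij i k) (sym (edgeless-ki i k))
    by (no _) (yes refl) _           = refl
    by (no _) (no _) (yes refl)      = trans (edgeless-ki i j) (sym (edgeless-ij i j))
    by (no i≢j) (no j≢k) (no k≢i)    = trans (edgeless-none i≢j j≢k k≢i) (sym (edgeless-none (≢-sym k≢i) (≢-sym j≢k) (≢-sym i≢j)))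

  triple-swap₁₂ : ∀ i j k → triple i j k ≡ triple j i k
  triple-swap₁₂ i j k = by (adj? G i j) (adj? G j k) (adj? G k i)
    where
    by : Dec (Adj G i j) → Dec (Adj G j k) → Dec (Adj G k i) → triple i j k ≡ triple j i k
    by (yes ij) _ _ = trans (triple-ij k ij) (trans (viaEdge-swap i j k) (sym (triple-ij k (adj-sym G ij))))
    by (no _) (yes jk) _ = trans (triple-jk i jk) (trans (viaEdge-swap j k i) (sym (triple-ki i (adj-sym G jk))))
    by (no _) (no _) (yes ki) = trans (triple-ki j ki) (trans (viaEdge-swap k i j) (sym (triple-jk j (adj-sym G ki))))
    by (no ¬ij) (no ¬jk) (no ¬ki) = trans (triple-none ¬ij ¬jk ¬ki) (trans (edgeless-swap₁₂ i j k)
      (sym (triple-none (¬ij ∘ adj-sym G) (¬ki ∘ adj-sym G) (¬jk ∘ adj-sym G))))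

  triple-swap₂₃ : ∀ i j k → triple i j k ≡ triple i k j
  triple-swap₂₃ i j k = by (adj? G i j) (adj? G j k) (adj? G k i)
    where
    by : Dec (Adj G i j) → Dec (Adj G j k) → Dec (Adj G k i) → triple i j k ≡ triple i k j
    by (yes ij) _ _ = trans (triple-ij k ij) (trans (viaEdge-swap i j k) (sym (triple-ki k (adj-sym G ij))))
    by (no _) (yes jk) _ = trans (triple-jk i jk) (trans (viaEdge-swap j k i) (sym (triple-jk i (adj-sym G jk))))
    by (no _) (no _) (yes ki) = trans (triple-ki j ki) (trans (viaEdge-swap k i j) (sym (triple-ij j (adj-sym G ki))))
    by (no ¬ij) (no ¬jk) (no ¬ki) = trans (triple-none ¬ij ¬jk ¬ki) (trans (edgeless-swap₂₃ i j k)
      (sym (triple-none (¬ki ∘ adj-sym G) (¬jk ∘ adj-sym G) (¬ij ∘ adj-sym G))))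

  -- Only an edge between k and i can conflict with `z`. It prescribes z k i + z i i = y (k , i) +
  -- 1, which is y (i , k) by the edge equation.
  triple-square : ∀ k i → triple k i i ≡ z i k
  triple-square k i = by (adj? G k i)
    where
    by : Dec (Adj G k i) → triple k i i ≡ z i k
    by (yes ki) = begin
      triple k i i              ≡⟨ triple-ij i ki ⟩
      z k i xor z i i           ≡⟨ cong₂ _xor_ (z-adj ki) (z-refl i) ⟩
      y (k , i) xor true        ≡⟨ xor-comm (y (k , i)) true ⟩
      not (y (k , i))           ≡⟨ solve-edge (adj-sym G ki) ⟨
      y (i , k)                 ≡⟨ z-adj (adj-sym G ki) ⟨
      z i k                     ∎
      where open ≡-Reasoning
    by (no ¬ki) = trans (triple-none ¬ki (adj-irrefl G refl) (¬ki ∘ adj-sym G)) (edgeless-jk k i)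

  triple-edge : ∀ {i j} k → Adj G i j → triple k i i xor (triple k i j xor triple k j j) ≡ false
  triple-edge {i} {j} k ij
    rewrite triple-square k i | triple-square k j | triple-jk k ij = cancel (z i k) (z j k)
    where
    cancel : ∀ a b → a xor ((a xor b) xor b) ≡ false
    cancel = solve 2 (λ a b → a :+ ((a :+ b) :+ b) ≔ con false) refl

  solution⇒¬certificate : ¬ HasDegreeOneCertificate G
  solution⇒¬certificate = Functional.¬certificate triple triple-swap₁₂ triple-swap₂₃ G
    (λ i → trans (triple-square i i) (z-refl i)) triple-edge

-- Loop programs in polynomial time

spine : Tree → ℕ
spine nil        = 0
spine (cons _ t) = suc (spine t)

times : ℕ → (A → A) → A → A
times zero    f x = x
times (suc k) f x = times k f (f x)

times-+ : ∀ j k (f : A → A) x → times (j + k) f x ≡ times k f (times j f x)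
times-+ zero    k f x = refl
times-+ (suc j) k f x = times-+ j k f (f x)

times-cong : ∀ k {f g : A → A} → (∀ x → f x ≡ g x) → ∀ x → times k f x ≡ times k g x
times-cong zero    e x = refl
times-cong (suc k) {g = g} e x = trans (times-cong k e _) (cong (times k g) (e x))

times-* : ∀ j k (f : A → A) x → times (j * k) f x ≡ times j (times k f) x
times-* zero    k f x = refl
times-* (suc j) k f x = trans (times-+ k (j * k) f x) (times-* j k f (times k f x))

branch : Tree → A → A → A
branch nil        x y = y
branch (cons _ _) x y = x

-- Functions on trees given a loop bound N.  The only loop is N-fold iteration, and elementary
-- operations have unit cost whatever the size of the trees, so all of them run in time polynomial in N.
infixr 5 _⟫_
data Fn : Set where
  expr : Expr 1 → Fn
  _⟫_  : Fn → Fn → Fn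
  keep : Fn → Fn
  cond : Expr 1 → Fn → Fn → Fn
  iter : Fn → Fn

⟦_⟧ : Fn → ℕ → Tree → Tree
⟦ expr e ⟧     N x = eval e (x ∷ [])
⟦ f ⟫ g ⟧      N x = ⟦ g ⟧ N (⟦ f ⟧ N x)
⟦ keep f ⟧     N x = cons (⟦ f ⟧ N x) x
⟦ cond e f g ⟧ N x = branch (eval e (x ∷ [])) (⟦ f ⟧ N x) (⟦ g ⟧ N x)
⟦ iter f ⟧     N x = times N (⟦ f ⟧ N) x

-- Register 0 holds the argument and the result, register 1 a stack, and register 2 a list of
-- length N, which is copied to the stack to count the passes of a loop.
pattern r₀ = zero
pattern r₁ = suc zero
pattern r₂ = suc (suc zero)

widen : Expr 1 → Expr 3
widen (reg zero)  = reg r₀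
widen nilᵉ        = nilᵉ
widen (consᵉ e f) = consᵉ (widen e) (widen f)
widen (hdᵉ e)     = hdᵉ (widen e)
widen (tlᵉ e)     = tlᵉ (widen e)

eval-widen : ∀ e {x} {σ : Store 2} → eval (widen e) (x ∷ σ) ≡ eval e (x ∷ [])
eval-widen (reg zero)  = refl
eval-widen nilᵉ        = refl
eval-widen (consᵉ e f) = cong₂ cons (eval-widen e) (eval-widen f)
eval-widen (hdᵉ e)     = cong hd (eval-widen e)
eval-widen (tlᵉ e)     = cong tl (eval-widen e)

-- Compiled code restores registers 1 and 2. This invariant is what allows loops to nest, each
-- copying its own counter from register 2.
compile : Fn → Cmd 3
compile (expr e)     = r₀ := widen e
compile (f ⟫ g)      = compile f ⨾ compile g
compile (keep f)     = r₁ := consᵉ (reg r₀) (reg r₁) ⨾ compile f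
                       ⨾ r₀ := consᵉ (reg r₀) (hdᵉ (reg r₁)) ⨾ r₁ := tlᵉ (reg r₁)
compile (cond e f g) = if widen e then compile f else compile g
compile (iter f)     = r₁ := consᵉ (reg r₂) (reg r₁)
                       ⨾ (while hdᵉ (reg r₁) loop (r₁ := consᵉ (tlᵉ (hdᵉ (reg r₁))) (tlᵉ (reg r₁)) ⨾ compile f))
                       ⨾ r₁ := tlᵉ (reg r₁)

-- The constants are the costs of the assignments and tests in `compile`; a pass of a loop pays 3
-- for the test and 7 for the counter. Charging both branches of `cond` makes this an upper bound.
time : Fn → ℕ → ℕ
time (expr e)     N = 1 + cost (widen e)
time (f ⟫ g)      N = time f N + time g N
time (keep f)     N = 4 + (time f N + (5 + 3))
time (cond e f g) N = 1 + cost (widen e) + (time f N + time g N)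
time (iter f)     N = 4 + (N * (10 + time f N) + 3 + 3)

run : ∀ f {N} x s r → spine r ≡ N →
      Σ ℕ λ t → ⟨ compile f , x ∷ s ∷ r ∷ [] ⟩⇓ (⟦ f ⟧ N x ∷ s ∷ r ∷ []) [ t ] × t ≤ time f N
run (expr e) x s r eq = _ ,
  subst (λ v → ⟨ _ , _ ⟩⇓ (v ∷ s ∷ r ∷ []) [ 1 + cost (widen e) ]) (eval-widen e {x} {s ∷ r ∷ []}) run-:= , ℕ.≤-refl
run (f ⟫ g) {N} x s r eq =
  let t , p , t≤ = run f x s r eq
      u , q , u≤ = run g (⟦ f ⟧ N x) s r eq
  in t + u , run-⨾ p q , ℕ.+-mono-≤ t≤ u≤
run (keep f) x s r eq =
  let t , p , t≤ = run f x (cons x s) r eq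
  in 4 + (t + (5 + 3)) , run-⨾ run-:= (run-⨾ p (run-⨾ run-:= run-:=)) ,
     ℕ.+-monoʳ-≤ 4 (ℕ.+-monoˡ-≤ (5 + 3) t≤)
run (cond e f g) {N} x s r eq with eval e (x ∷ []) | eval-widen e {x} {s ∷ r ∷ []}
... | cons _ _ | e≡ =
  let t , p , t≤ = run f x s r eq
  in _ , run-then (subst Truthy (sym e≡) truthy) p , ℕ.+-monoʳ-≤ (1 + cost (widen e)) (ℕ.≤-trans t≤ (ℕ.m≤m+n _ _))
... | nil      | e≡ =
  let t , p , t≤ = run g x s r eq
  in _ , run-else e≡ p , ℕ.+-monoʳ-≤ (1 + cost (widen e)) (ℕ.≤-trans t≤ (ℕ.m≤n+m _ _))
run (iter f) {N} x s r eq =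
  let t , p , t≤ = passes N r eq x
  in 4 + (t + 3) , run-⨾ run-:= (run-⨾ p run-:=) , ℕ.+-monoʳ-≤ 4 (ℕ.+-monoˡ-≤ 3 t≤)
  where
  passes : ∀ k c → spine c ≡ k → ∀ x →
         Σ ℕ λ t → ⟨ while hdᵉ (reg r₁) loop (r₁ := consᵉ (tlᵉ (hdᵉ (reg r₁))) (tlᵉ (reg r₁)) ⨾ compile f) ,
                     x ∷ cons c s ∷ r ∷ [] ⟩⇓ (times k (⟦ f ⟧ N) x ∷ cons nil s ∷ r ∷ []) [ t ]
                 × t ≤ k * (10 + time f N) + 3
  passes zero    nil        refl x = _ , run-stop refl , ℕ.≤-refl
  passes (suc k) (cons h c) refl x =
    let t , p , t≤ = run f x (cons c s) r eq
        u , q , u≤ = passes k c refl (⟦ f ⟧ N x)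
    in _ , run-while truthy (run-⨾ run-:= p) q ,
       ℕ.≤-trans (ℕ.+-mono-≤ (ℕ.+-monoʳ-≤ 10 t≤) u≤) (ℕ.≤-reflexive (sym (ℕ.+-assoc (10 + time f N) (k * (10 + time f N)) 3)))

-- Degrees are added instead of maximised, so that `+-bound` serves all sums.
degree : Fn → ℕ
degree (expr e)     = 0
degree (f ⟫ g)      = degree f + degree g
degree (keep f)     = degree f
degree (cond e f g) = degree f + degree g
degree (iter f)     = suc (degree f)

factor : Fn → ℕ
factor (expr e)     = 1 + cost (widen e)
factor (f ⟫ g)      = factor f + factor g
factor (keep f)     = 12 + factor f
factor (cond e f g) = 1 + cost (widen e) + (factor f + factor g)
factor (iter f)     = 20 + factor f

module _ (N : ℕ) .{{_ : NonZero N}} where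

  1≤^ : ∀ d → 1 ≤ N ℕ.^ d
  1≤^ d = ℕ.m^n>0 N d

  const≤ : ∀ c d → c ≤ c * N ℕ.^ d
  const≤ c d = ℕ.≤-trans (ℕ.≤-reflexive (sym (ℕ.*-identityʳ c))) (ℕ.*-monoʳ-≤ c (1≤^ d))

  +-bound : ∀ {t u} c c′ d d′ → t ≤ c * N ℕ.^ d → u ≤ c′ * N ℕ.^ d′ → t + u ≤ (c + c′) * N ℕ.^ (d + d′)
  +-bound {t} {u} c c′ d d′ p q = begin
    t + u                                              ≤⟨ ℕ.+-mono-≤ p q ⟩
    c * N ℕ.^ d + c′ * N ℕ.^ d′                        ≤⟨ ℕ.+-mono-≤ (ℕ.*-monoʳ-≤ c (ℕ.^-monoʳ-≤ N (ℕ.m≤m+n d d′)))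
                                                                      (ℕ.*-monoʳ-≤ c′ (ℕ.^-monoʳ-≤ N (ℕ.m≤n+m d′ d))) ⟩
    c * N ℕ.^ (d + d′) + c′ * N ℕ.^ (d + d′)           ≡⟨ ℕ.*-distribʳ-+ (N ℕ.^ (d + d′)) c c′ ⟨
    (c + c′) * N ℕ.^ (d + d′)                          ∎
    where open ℕ.≤-Reasoning

  time≤ : ∀ f → time f N ≤ factor f * N ℕ.^ degree f
  time≤ (expr e)     = const≤ (1 + cost (widen e)) 0
  time≤ (f ⟫ g)      = +-bound (factor f) (factor g) (degree f) (degree g) (time≤ f) (time≤ g)
  time≤ (keep f)     = ℕ.≤-trans
    (ℕ.≤-reflexive (trans (cong (4 +_) (ℕ.+-comm (time f N) 8)) refl))
    (+-bound 12 (factor f) 0 (degree f) (const≤ 12 0) (time≤ f))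
  time≤ (cond e f g) = +-bound (1 + cost (widen e)) (factor f + factor g) 0 (degree f + degree g)
    (const≤ (1 + cost (widen e)) 0) (+-bound (factor f) (factor g) (degree f) (degree g) (time≤ f) (time≤ g))
  time≤ (iter f)     = begin
    4 + (N * (10 + time f N) + 3 + 3)               ≡⟨ regroup N (time f N) ⟩
    10 + N * (10 + time f N)                        ≤⟨ ℕ.+-mono-≤ (const≤ 10 (suc d)) (ℕ.*-monoʳ-≤ N (ℕ.+-mono-≤ (const≤ 10 d) (time≤ f))) ⟩
    10 * N ℕ.^ suc d + N * (10 * N ℕ.^ d + factor f * N ℕ.^ d)
                                                    ≡⟨ collect N (factor f) (N ℕ.^ d) ⟩
    (20 + factor f) * N ℕ.^ suc d                   ∎
    where
    open ℕ.≤-Reasoning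
    open +-*-Solver using () renaming (solve to solveℕ; con to conℕ; _:+_ to _⊹_; _:*_ to _⋆_; _:=_ to _≕_)
    d = degree f
    regroup : ∀ N t → 4 + (N * (10 + t) + 3 + 3) ≡ 10 + N * (10 + t)
    regroup = solveℕ 2 (λ N t → conℕ 4 ⊹ (N ⋆ (conℕ 10 ⊹ t) ⊹ conℕ 3 ⊹ conℕ 3) ≕ conℕ 10 ⊹ N ⋆ (conℕ 10 ⊹ t)) refl
    collect : ∀ N c M → 10 * (N * M) + N * (10 * M + c * M) ≡ (20 + c) * (N * M)
    collect = solveℕ 3 (λ N c M → conℕ 10 ⋆ (N ⋆ M) ⊹ N ⋆ (conℕ 10 ⋆ M ⊹ c ⋆ M) ≕ (conℕ 20 ⊹ c) ⋆ (N ⋆ M)) refl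

-- Generating the system

pattern arg = reg zero

-- The step receives the whole suffix: on an encoded list it reads the head, on a unary numeral the
-- suffix itself is the loop variable.
walk : (Tree → Tree → Tree) → Tree → Tree → Tree
walk g nil        acc = acc
walk g (cons h t) acc = walk g t (g (cons h t) acc)

iterᵖ : ℕ → Fn → Fn
iterᵖ zero    f = f
iterᵖ (suc p) f = iter (iterᵖ p f)

iterᵖ-sem : ∀ p f x → ⟦ iterᵖ p f ⟧ N x ≡ times (N ℕ.^ p) (⟦ f ⟧ N) x
iterᵖ-sem         zero    f x = refl
iterᵖ-sem {N = N} (suc p) f x = trans (times-cong N (iterᵖ-sem p f) x) (sym (times-* N (N ℕ.^ p) (⟦ f ⟧ N) x))

-- for p body maps (cur , (env , acc)) to the accumulator obtained by replacing acc with
-- body ((c , env) , acc) for every nonempty suffix c of cur.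
forStep : Fn → Fn
forStep body = cond (hdᵉ arg)
  (keep (expr (consᵉ (consᵉ (hdᵉ arg) (hdᵉ (tlᵉ arg))) (tlᵉ (tlᵉ arg))) ⟫ body)
   ⟫ expr (consᵉ (tlᵉ (hdᵉ (tlᵉ arg))) (consᵉ (hdᵉ (tlᵉ (tlᵉ arg))) (hdᵉ arg))))
  (expr arg)

for : ℕ → Fn → Fn
for p body = iterᵖ p (forStep body) ⟫ expr (tlᵉ (tlᵉ arg))

-- Once `cur` is empty a step changes nothing, so surplus passes are idle and only an upper bound on
-- the length is required.
for-sem : ∀ p body cur env acc → spine cur ≤ N ℕ.^ p →
          ⟦ for p body ⟧ N (cons cur (cons env acc)) ≡ walk (λ c a → ⟦ body ⟧ N (cons (cons c env) a)) cur acc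
for-sem {N = N} p body cur env acc cur≤ =
  cong (tl ∘ tl) (trans (iterᵖ-sem p (forStep body) _) (go (N ℕ.^ p) cur acc cur≤))
  where
  go : ∀ k cur acc → spine cur ≤ k → times k (⟦ forStep body ⟧ N) (cons cur (cons env acc)) ≡
       cons nil (cons env (walk (λ c a → ⟦ body ⟧ N (cons (cons c env) a)) cur acc))
  go zero    nil        acc le       = refl
  go (suc k) nil        acc le       = go k nil acc z≤n
  go (suc k) (cons h t) acc (s≤s le) = go k t _ le

-- The step is assumed correct only on members of the list, because the candidates meet their length
-- bounds one by one.
walk-encodeList : ∀ {g : Tree → Tree → Tree} (enc : X → Tree) (f : A → Tree) (F : X → A → X) {xs} →
  All (λ x → ∀ c acc → g (cons (f x) c) (enc acc) ≡ enc (F acc x)) xs →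
  ∀ acc → walk g (encodeList f xs) (enc acc) ≡ enc (foldl F acc xs)
walk-encodeList enc f F [] acc = refl
walk-encodeList {g = g} enc f F {x ∷ xs} (h ∷ hs) acc =
  trans (cong (walk g (encodeList f xs)) (h (encodeList f xs) acc)) (walk-encodeList enc f F hs _)

spine-encodeList : ∀ (f : A → Tree) xs → spine (encodeList f xs) ≡ length xs
spine-encodeList f []       = refl
spine-encodeList f (x ∷ xs) = cong suc (spine-encodeList f xs)

unary : ℕ → Tree
unary zero    = nil
unary (suc k) = cons nil (unary k)

spine-unary : ∀ k → spine (unary k) ≡ k
spine-unary zero    = refl
spine-unary (suc k) = cong suc (spine-unary k)

-- In a loop over unary n the suffixes of positive length represent the vertices.
vertex : Fin n → Tree
vertex i = unary (suc (Fin.toℕ i))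

-- The numeral shrinks, so the vertices come in descending order, with vertex 0 outermost; this is a
-- right fold.
walk-unary : ∀ (g : Tree → Tree → Tree) n acc →
             walk g (unary n) acc ≡ foldr (λ i → g (vertex i)) acc (allFin n)
walk-unary g n acc = trans (walk-up n acc) (up-foldr (λ k → g (unary (suc k))) n acc)
  where
  up : (ℕ → Tree → Tree) → ℕ → Tree → Tree
  up h zero    acc = acc
  up h (suc k) acc = up h k (h k acc)
  walk-up : ∀ n acc → walk g (unary n) acc ≡ up (λ k → g (unary (suc k))) n acc
  walk-up zero    acc = refl
  walk-up (suc n) acc = walk-up n _
  up-suc : ∀ h k acc → up h (suc k) acc ≡ h 0 (up (h ∘ suc) k acc)
  up-suc h zero    acc = refl
  up-suc h (suc k) acc = up-suc h k (h (suc k) acc)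
  up-foldr : ∀ h n acc → up h n acc ≡ foldr (λ i → h (Fin.toℕ i)) acc (allFin n)
  up-foldr h zero    acc = refl
  up-foldr h (suc k) acc = trans (up-suc h k acc)
    (cong (h 0) (trans (up-foldr (h ∘ suc) k acc) (sym (foldr-suc {k} (λ i → h (Fin.toℕ i)) acc))))
    where
    foldr-suc : ∀ {k} (h : Fin (suc k) → Tree → Tree) acc → foldr h acc (tabulate suc) ≡ foldr (h ∘ suc) acc (allFin k)
    foldr-suc {k} h acc = trans (cong (foldr h acc) (sym (map-tabulate id suc))) (foldr-map h suc acc (allFin k))

-- The expression e must find unary n in the state (env , acc).
forVertices : Expr 1 → Fn → Fn
forVertices e body = expr (consᵉ e arg) ⟫ for 1 body

forVertices-sem : ∀ e body (enc : X → Tree) {F : Fin n → X → X} env acc →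
  eval e (cons env (enc acc) ∷ []) ≡ unary n → n ≤ N →
  (∀ i acc → ⟦ body ⟧ N (cons (cons (vertex i) env) (enc acc)) ≡ enc (F i acc)) →
  ⟦ forVertices e body ⟧ N (cons env (enc acc)) ≡ enc (foldr F acc (allFin n))
forVertices-sem {n = n} {N} e body enc {F} env acc e≡ n≤N h rewrite e≡ = trans
  (for-sem {N = N} 1 body (unary n) env (enc acc)
    (ℕ.≤-trans (ℕ.≤-reflexive (spine-unary n)) (ℕ.≤-trans n≤N (ℕ.≤-reflexive (sym (ℕ.*-identityʳ N))))))
  (trans (walk-unary (λ c a → ⟦ body ⟧ N (cons (cons c env) a)) n (enc acc)) (go (allFin n)))
  where
  go : ∀ is → foldr (λ i a → ⟦ body ⟧ N (cons (cons (vertex i) env) a)) (enc acc) is ≡ enc (foldr F acc is)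
  go []       = refl
  go (i ∷ is) = trans (cong (λ a → ⟦ body ⟧ N (cons (cons (vertex i) env) a)) (go is)) (h i (foldr F acc is))

foldr-cartesianProduct : ∀ (g : A × B → X → X) z xs ys →
  foldr g z (cartesianProduct xs ys) ≡ foldr (λ x z → foldr (λ y → g (x , y)) z ys) z xs
foldr-cartesianProduct g z []       ys = refl
foldr-cartesianProduct g z (x ∷ xs) ys = trans (foldr-++ g z (map (x ,_) ys) (cartesianProduct xs ys))
  (trans (foldr-map g (x ,_) _ ys) (cong (λ z → foldr (λ y → g (x , y)) z ys) (foldr-cartesianProduct g z xs ys)))

trueᵉ : Expr 1
trueᵉ = consᵉ nilᵉ nilᵉ

nth : Fn
nth = iter (cond (hdᵉ arg) (expr (consᵉ (tlᵉ (hdᵉ arg)) (tlᵉ (tlᵉ arg)))) (expr arg)) ⟫ expr (hdᵉ (tlᵉ arg))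

nth-sem : ∀ (f : A → Tree) (g : Fin n → A) i → n ≤ N →
          ⟦ nth ⟧ N (cons (unary (Fin.toℕ i)) (encodeList f (tabulate g))) ≡ f (g i)
nth-sem {N = N} f g i n≤N = trans
  (cong (hd ∘ tl) (go N (Fin.toℕ i) (encodeList f (tabulate g)) (ℕ.≤-trans (Fin.toℕ≤n i) n≤N)))
  (hd-drop g i)
  where
  go : ∀ K k l → k ≤ K →
       times K (⟦ cond (hdᵉ arg) (expr (consᵉ (tlᵉ (hdᵉ arg)) (tlᵉ (tlᵉ arg)))) (expr arg) ⟧ N) (cons (unary k) l)
       ≡ cons nil (times k tl l)
  go zero    zero    l _        = refl
  go (suc K) zero    l _        = go K zero l z≤n
  go (suc K) (suc k) l (s≤s le) = go K k (tl l) le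
  hd-drop : ∀ {n} (g : Fin n → _) i → hd (times (Fin.toℕ i) tl (encodeList f (tabulate g))) ≡ f (g i)
  hd-drop g zero    = refl
  hd-drop g (suc i) = hd-drop (g ∘ suc) i

encodeArc : Arc n → Tree
encodeArc (i , j) = cons (vertex i) (vertex j)

encodeArcs : List (Arc n) → Tree
encodeArcs = encodeList encodeArc

-- A vertex i is the numeral i + 1, so its tail is the index that `nth` expects.
adjacent : Fn
adjacent = keep (expr (consᵉ (tlᵉ (hdᵉ (hdᵉ arg))) (tlᵉ arg)) ⟫ nth)
         ⟫ expr (consᵉ (tlᵉ (tlᵉ (hdᵉ (tlᵉ arg)))) (hdᵉ arg)) ⟫ nth

adjacent-sem : ∀ (G : Graph n) i j → n ≤ N →
               ⟦ adjacent ⟧ N (cons (encodeArc (i , j)) (encodeGraph G)) ≡ encodeBool (does (adj? G i j))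
adjacent-sem {n} {N} G i j n≤N = trans
  (cong (λ r → ⟦ nth ⟧ N (cons (unary (Fin.toℕ j)) r))
        (nth-sem (λ i → encodeList (λ j → encodeBool (does (adj? G i j))) (allFin n)) id i n≤N))
  (nth-sem (λ j → encodeBool (does (adj? G i j))) id j n≤N)

times-fixed : ∀ k {f : A → A} {x} → f x ≡ x → times k f x ≡ x
times-fixed zero    e = refl
times-fixed (suc k) {f} e = trans (cong (times k f) e) (times-fixed k e)

equalStep : Fn
equalStep = cond (hdᵉ arg) (cond (tlᵉ arg) (expr (consᵉ (tlᵉ (hdᵉ arg)) (tlᵉ (tlᵉ arg)))) (expr arg)) (expr arg)

bothEmpty : Fn
bothEmpty = cond (hdᵉ arg) (expr nilᵉ) (cond (tlᵉ arg) (expr nilᵉ) (expr trueᵉ))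

equal : Fn
equal = iter equalStep ⟫ bothEmpty

equal-sem : ∀ a b → a ≤ N → ⟦ equal ⟧ N (cons (unary a) (unary b)) ≡ encodeBool (does (a ℕ.≟ b))
equal-sem {N} = go N
  where
  go : ∀ K a b → a ≤ K → ⟦ bothEmpty ⟧ N (times K (⟦ equalStep ⟧ N) (cons (unary a) (unary b))) ≡ encodeBool (does (a ℕ.≟ b))
  go K       zero    zero    _        = cong (⟦ bothEmpty ⟧ N) (times-fixed K refl)
  go K       zero    (suc b) _        = cong (⟦ bothEmpty ⟧ N) (times-fixed K refl)
  go K       (suc a) zero    _        = cong (⟦ bothEmpty ⟧ N) (times-fixed K refl)
  go (suc K) (suc a) (suc b) (s≤s le) = go K a b le

equalArc : Fn
equalArc = keep (expr (consᵉ (hdᵉ (hdᵉ arg)) (hdᵉ (tlᵉ arg))) ⟫ equal)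
         ⟫ cond (hdᵉ arg) (expr (consᵉ (tlᵉ (hdᵉ (tlᵉ arg))) (tlᵉ (tlᵉ (tlᵉ arg)))) ⟫ equal) (expr nilᵉ)

equalVertex-sem : ∀ (i j : Fin n) → n ≤ N → ⟦ equal ⟧ N (cons (vertex i) (vertex j)) ≡ encodeBool (does (i Fin.≟ j))
equalVertex-sem i j n≤N = trans (equal-sem _ _ (ℕ.≤-trans (Fin.toℕ<n i) n≤N))
  (cong encodeBool (does-⇔ (mk⇔ (Fin.toℕ-injective ∘ ℕ.suc-injective) (cong (suc ∘ Fin.toℕ))) (suc (Fin.toℕ i) ℕ.≟ suc (Fin.toℕ j)) (i Fin.≟ j)))

equalArc-sem : ∀ (a b : Arc n) → n ≤ N → ⟦ equalArc ⟧ N (cons (encodeArc a) (encodeArc b)) ≡ encodeBool (does (a ≟ᵃ b))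
equalArc-sem {n} {N} (i , j) (k , l) n≤N rewrite equalVertex-sem {N = N} i k n≤N = trans
  (branches (does (i Fin.≟ k)) (equalVertex-sem j l n≤N))
  (cong encodeBool (does-⇔ (mk⇔ (λ (p , q) → cong₂ _,_ p q) (λ e → cong proj₁ e , cong proj₂ e))
                           (i Fin.≟ k ×-dec j Fin.≟ l) ((i , j) ≟ᵃ (k , l))))
  where
  branches : ∀ b {c t} → t ≡ encodeBool c → branch (encodeBool b) t nil ≡ encodeBool (b ∧ c)
  branches false _ = refl
  branches true  e = e

entryStep : Fn
entryStep = keep (expr (consᵉ (hdᵉ (hdᵉ (hdᵉ arg))) (tlᵉ (hdᵉ arg))) ⟫ equalArc)
          ⟫ cond (hdᵉ arg) (cond (tlᵉ (tlᵉ arg)) (expr nilᵉ) (expr trueᵉ)) (expr (tlᵉ (tlᵉ arg)))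

-- (A , a) ↦ at A a
entry : Fn
entry = expr (consᵉ (hdᵉ arg) (consᵉ (tlᵉ arg) nilᵉ)) ⟫ for 2 entryStep

entry-sem : ∀ (A : List (Arc n)) a → n ≤ N → length A ≤ N ℕ.^ 2 →
            ⟦ entry ⟧ N (cons (encodeArcs A) (encodeArc a)) ≡ encodeBool (at A a)
entry-sem {n} {N} A a n≤N A≤ = trans
  (for-sem {N = N} 2 entryStep (encodeArcs A) (encodeArc a) nil (ℕ.≤-trans (ℕ.≤-reflexive (spine-encodeList encodeArc A)) A≤))
  (trans (walk-encodeList encodeBool encodeArc F {A} (All.tabulate (λ {b} _ → step b)) false)
         (cong encodeBool (trans (collect A false) (xor-identityʳ (at A a)))))
  where
  F : Bool → Arc n → Bool
  F acc b = does (b ≟ᵃ a) xor acc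
  step : ∀ b c acc → ⟦ entryStep ⟧ N (cons (cons (cons (encodeArc b) c) (encodeArc a)) (encodeBool acc)) ≡ encodeBool (F acc b)
  step b c acc rewrite equalArc-sem {N = N} b a n≤N = add (does (b ≟ᵃ a)) acc
    where
    add : ∀ p q → branch (encodeBool p) (branch (encodeBool q) nil (cons nil nil)) (encodeBool q) ≡ encodeBool (p xor q)
    add false q     = refl
    add true  false = refl
    add true  true  = refl
  collect : ∀ A acc → foldl F acc A ≡ at A a xor acc
  collect []      acc = refl
  collect (b ∷ A) acc = trans (collect A _) (trans (sym (xor-assoc (at A a) (does (b ≟ᵃ a)) acc))
    (cong (_xor acc) (xor-comm (at A a) (does (b ≟ᵃ a)))))

-- Entries are prepended while the vertices descend, so a row is built from its last entry c
-- backwards and ends up in the order of `pairs n`.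
rowStep : Fn
rowStep = keep (expr (consᵉ (tlᵉ (tlᵉ (tlᵉ (hdᵉ arg)))) (consᵉ (hdᵉ (tlᵉ (hdᵉ arg))) (hdᵉ (hdᵉ arg)))) ⟫ entry)
        ⟫ expr (consᵉ (hdᵉ arg) (tlᵉ (tlᵉ arg)))

-- ((vertices , A) , c) ↦ row A c
rowFn : Fn
rowFn = expr (consᵉ (hdᵉ arg) (consᵉ (tlᵉ arg) nilᵉ))
      ⟫ forVertices (hdᵉ (hdᵉ arg)) (forVertices (hdᵉ (tlᵉ (hdᵉ arg))) rowStep)

encodeRow : Vec Bool m → Tree
encodeRow []      = nil
encodeRow (b ∷ v) = cons (encodeBool b) (encodeRow v)

encodeRows : List (Vec Bool m) → Tree
encodeRows = encodeList encodeRow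

rowFn-sem : ∀ (A : List (Arc n)) c → n ≤ N → length A ≤ N ℕ.^ 2 →
            ⟦ rowFn ⟧ N (cons (cons (unary n) (encodeArcs A)) (encodeBool c)) ≡ encodeRow (row A c (pairs n))
rowFn-sem {n} {N} A c n≤N A≤ = trans
  (forVertices-sem (hdᵉ (hdᵉ arg)) (forVertices (hdᵉ (tlᵉ (hdᵉ arg))) rowStep) enc env (c ∷ []) refl n≤N
    (λ i acc → forVertices-sem (hdᵉ (tlᵉ (hdᵉ arg))) rowStep enc (cons (vertex i) env) acc refl n≤N
      (λ j acc → cong (λ t → cons t (enc acc)) (entry-sem A (i , j) n≤N A≤))))
  (trans (cong enc (sym (foldr-cartesianProduct (λ a → at A a ∷_) (c ∷ []) (allFin n) (allFin n)))) (assemble (pairs n)))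
  where
  enc = encodeList encodeBool
  env = cons (unary n) (encodeArcs A)
  assemble : ∀ cols → enc (foldr (λ a → at A a ∷_) (c ∷ []) cols) ≡ encodeRow (row A c cols)
  assemble []         = refl
  assemble (a ∷ cols) = cong (cons (encodeBool (at A a))) (assemble cols)

allAdjStep : Fn
allAdjStep = cond (tlᵉ arg) (expr (consᵉ (hdᵉ (hdᵉ (hdᵉ arg))) (tlᵉ (hdᵉ arg))) ⟫ adjacent) (expr nilᵉ)

allAdj-sem : ∀ (G : Graph n) B → n ≤ N → length B ≤ N ℕ.^ 2 →
             ⟦ for 2 allAdjStep ⟧ N (cons (encodeArcs B) (cons (encodeGraph G) (cons nil nil))) ≡ encodeBool (allAdj G true B)
allAdj-sem {n} {N} G B n≤N B≤ = trans
  (for-sem {N = N} 2 allAdjStep (encodeArcs B) (encodeGraph G) (cons nil nil) (ℕ.≤-trans (ℕ.≤-reflexive (spine-encodeList encodeArc B)) B≤))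
  (trans (walk-encodeList encodeBool encodeArc F {B} (All.tabulate (λ {a} _ → step a)) true) (cong encodeBool (collect true B)))
  where
  F : Bool → Arc n → Bool
  F b (i , j) = ifᵇ b then does (adj? G i j) else false
  step : ∀ a c b → ⟦ allAdjStep ⟧ N (cons (cons (cons (encodeArc a) c) (encodeGraph G)) (encodeBool b)) ≡ encodeBool (F b a)
  step (i , j) c false = refl
  step (i , j) c true  = adjacent-sem G i j n≤N
  collect : ∀ b B → foldl F b B ≡ allAdj G b B
  collect b []            = refl
  collect b ((i , j) ∷ B) = collect _ B

encodeCandidate : Candidate n → Tree
encodeCandidate (B , A , c) = cons (encodeArcs B) (cons (encodeArcs A) (encodeBool c))

context : Graph n → Tree
context {n} G = cons (unary n) (encodeGraph G)

-- (candidate , (context , rows)) ↦ rows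
emitFn : Fn
emitFn = keep (expr (consᵉ (hdᵉ (hdᵉ arg)) (consᵉ (tlᵉ (hdᵉ (tlᵉ arg))) trueᵉ)) ⟫ for 2 allAdjStep)
       ⟫ cond (hdᵉ arg)
           (keep (expr (consᵉ (consᵉ (hdᵉ (hdᵉ (tlᵉ (tlᵉ arg)))) (hdᵉ (tlᵉ (hdᵉ (tlᵉ arg))))) (tlᵉ (tlᵉ (hdᵉ (tlᵉ arg))))) ⟫ rowFn)
            ⟫ expr (consᵉ (hdᵉ arg) (tlᵉ (tlᵉ (tlᵉ (tlᵉ arg))))))
           (expr (tlᵉ (tlᵉ (tlᵉ arg))))

emitFn-sem : ∀ (G : Graph n) x rs → n ≤ N → length (proj₁ x) ≤ N ℕ.^ 2 → length (proj₁ (proj₂ x)) ≤ N ℕ.^ 2 →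
             ⟦ emitFn ⟧ N (cons (encodeCandidate x) (cons (context G) (encodeRows rs))) ≡ encodeRows (emit G x rs)
emitFn-sem {n} {N} G (B , A , c) rs n≤N B≤ A≤ rewrite allAdj-sem {N = N} G B n≤N B≤ with allAdj G true B
... | false = refl
... | true  = cong (λ r → cons r (encodeRows rs)) (rowFn-sem A c n≤N A≤)

listᵉ : List (Expr 1) → Expr 1
listᵉ = foldr consᵉ nilᵉ

-- In the state ((l , (k , (j , (i , context)))) , rows)
iᵉ jᵉ kᵉ lᵉ contextᵉ : Expr 1
lᵉ       = hdᵉ (hdᵉ arg)
kᵉ       = hdᵉ (tlᵉ (hdᵉ arg))
jᵉ       = hdᵉ (tlᵉ (tlᵉ (hdᵉ arg)))
iᵉ       = hdᵉ (tlᵉ (tlᵉ (tlᵉ (hdᵉ arg))))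
contextᵉ = tlᵉ (tlᵉ (tlᵉ (tlᵉ (hdᵉ arg))))

candidatesᵉ : Expr 1
candidatesᵉ = listᵉ
  ( consᵉ (listᵉ (consᵉ iᵉ jᵉ ∷ []))
          (consᵉ (listᵉ (consᵉ iᵉ jᵉ ∷ consᵉ jᵉ iᵉ ∷ [])) trueᵉ)
  ∷ consᵉ (listᵉ (consᵉ iᵉ jᵉ ∷ consᵉ jᵉ kᵉ ∷ consᵉ kᵉ iᵉ ∷ []))
          (consᵉ (listᵉ (consᵉ iᵉ jᵉ ∷ consᵉ jᵉ kᵉ ∷ [])) nilᵉ)
  ∷ consᵉ (listᵉ (consᵉ iᵉ jᵉ ∷ consᵉ jᵉ kᵉ ∷ consᵉ kᵉ lᵉ ∷ consᵉ lᵉ iᵉ ∷ []))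
          (consᵉ (listᵉ (consᵉ iᵉ jᵉ ∷ consᵉ jᵉ kᵉ ∷ consᵉ kᵉ lᵉ ∷ consᵉ lᵉ iᵉ ∷ [])) nilᵉ)
  ∷ [])

emitStep : Fn
emitStep = expr (consᵉ (hdᵉ (hdᵉ (hdᵉ arg))) (consᵉ (tlᵉ (hdᵉ arg)) (tlᵉ arg))) ⟫ emitFn

emitsFn : Fn
emitsFn = expr (consᵉ candidatesᵉ (consᵉ contextᵉ (tlᵉ arg))) ⟫ for 2 emitStep

emitsFn-sem : ∀ (G : Graph n) i j k l rs → n ≤ N → 4 ≤ N ℕ.^ 2 →
  ⟦ emitsFn ⟧ N (cons (cons (vertex l) (cons (vertex k) (cons (vertex j) (cons (vertex i) (context G))))) (encodeRows rs))
  ≡ encodeRows (foldl (λ rs x → emit G x rs) rs (candidates (i , j , k , l)))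
emitsFn-sem {n} {N} G i j k l rs n≤N 4≤ = trans
  (for-sem {N = N} 2 emitStep (encodeList encodeCandidate (candidates (i , j , k , l))) (context G) (encodeRows rs)
    (ℕ.≤-trans (ℕ.n≤1+n 3) 4≤))
  (walk-encodeList {g = λ c a → ⟦ emitStep ⟧ N (cons (cons c (context G)) a)} encodeRows
    encodeCandidate (λ rs x → emit G x rs) {candidates (i , j , k , l)}
    ( (λ _ rs → emitFn-sem {N = N} G (candidate 0F) rs n≤N (ℕ.≤-trans (ℕ.m≤m+n 1 3) 4≤) (ℕ.≤-trans (ℕ.m≤m+n 2 2) 4≤))
    ∷ (λ _ rs → emitFn-sem {N = N} G (candidate 1F) rs n≤N (ℕ.≤-trans (ℕ.m≤m+n 3 1) 4≤) (ℕ.≤-trans (ℕ.m≤m+n 2 2) 4≤))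
    ∷ (λ _ rs → emitFn-sem {N = N} G (candidate 2F) rs n≤N 4≤ 4≤)
    ∷ []) rs)
  where
  candidate = lookup (candidates (i , j , k , l))

rowsFn₁ rowsFn₂ rowsFn₃ rowsFn : Fn
rowsFn₁ = forVertices (hdᵉ (tlᵉ (tlᵉ (tlᵉ (hdᵉ arg))))) emitsFn
rowsFn₂ = forVertices (hdᵉ (tlᵉ (tlᵉ (hdᵉ arg)))) rowsFn₁
rowsFn₃ = forVertices (hdᵉ (tlᵉ (hdᵉ arg))) rowsFn₂
rowsFn  = forVertices (hdᵉ (hdᵉ arg)) rowsFn₃

rowsFn-sem : ∀ (G : Graph n) → n ≤ N → 4 ≤ N ℕ.^ 2 → ⟦ rowsFn ⟧ N (cons (context G) nil) ≡ encodeRows (rows G)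
rowsFn-sem {n} {N} G n≤N 4≤ = trans
  (forVertices-sem (hdᵉ (hdᵉ arg)) rowsFn₃ encodeRows (context G) [] refl n≤N λ i rs →
   forVertices-sem (hdᵉ (tlᵉ (hdᵉ arg))) rowsFn₂ encodeRows (cons (vertex i) (context G)) rs refl n≤N λ j rs →
   forVertices-sem (hdᵉ (tlᵉ (tlᵉ (hdᵉ arg)))) rowsFn₁ encodeRows (cons (vertex j) (cons (vertex i) (context G))) rs refl n≤N λ k rs →
   forVertices-sem (hdᵉ (tlᵉ (tlᵉ (tlᵉ (hdᵉ arg))))) emitsFn encodeRows
     (cons (vertex k) (cons (vertex j) (cons (vertex i) (context G)))) rs refl n≤N λ l rs →
   emitsFn-sem {N = N} G i j k l rs n≤N 4≤)
  (cong encodeRows (sym (trans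
    (foldr-cartesianProduct F [] (allFin n) (cartesianProduct (allFin n) (pairs n)))
    (foldr-cong (λ i rs → trans (foldr-cartesianProduct (λ q → F (i , q)) rs (allFin n) (pairs n))
      (foldr-cong (λ j rs → foldr-cartesianProduct (λ q → F (i , j , q)) rs (allFin n) (allFin n)) (allFin n) rs)) (allFin n) []))))
  where
  F : Quad n → List (Row n) → List (Row n)
  F q rs = foldl (λ rs x → emit G x rs) rs (candidates q)
  foldr-cong : ∀ {F F′ : Fin n → X → X} → (∀ i x → F i x ≡ F′ i x) → ∀ is x → foldr F x is ≡ foldr F′ x is
  foldr-cong         e []       x = refl
  foldr-cong {F = F} e (i ∷ is) x = trans (cong (F i) (foldr-cong e is x)) (e i _)

-- Gaussian elimination on trees

xorStep : Fn
xorStep = cond (hdᵉ (hdᵉ (hdᵉ arg)))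
  (cond (hdᵉ (hdᵉ (tlᵉ arg)))
    (expr (consᵉ (tlᵉ (hdᵉ (tlᵉ arg))) (consᵉ nilᵉ (tlᵉ (tlᵉ arg)))))
    (expr (consᵉ (tlᵉ (hdᵉ (tlᵉ arg))) (consᵉ trueᵉ (tlᵉ (tlᵉ arg))))))
  (expr (consᵉ (tlᵉ (hdᵉ (tlᵉ arg))) (consᵉ (hdᵉ (hdᵉ (tlᵉ arg))) (tlᵉ (tlᵉ arg)))))

pushStep : Fn
pushStep = expr (consᵉ (hdᵉ (hdᵉ (hdᵉ arg))) (tlᵉ arg))

-- The first loop computes the sum in reverse.
xorFn : Fn
xorFn = expr (consᵉ (hdᵉ arg) (consᵉ nilᵉ (consᵉ (tlᵉ arg) nilᵉ))) ⟫ for 2 xorStep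
      ⟫ expr (consᵉ (tlᵉ arg) (consᵉ nilᵉ nilᵉ)) ⟫ for 2 pushStep

encodeRow-onto : Vec Bool m → Tree → Tree
encodeRow-onto []      t = t
encodeRow-onto (b ∷ v) t = encodeRow-onto v (cons (encodeBool b) t)

spine-onto : ∀ (v : Vec Bool m) t → spine (encodeRow-onto v t) ≡ m + spine t
spine-onto []      t = refl
spine-onto (b ∷ v) t = trans (spine-onto v _) (ℕ.+-suc _ (spine t))

spine-encodeRow : ∀ (v : Vec Bool m) → spine (encodeRow v) ≡ m
spine-encodeRow []      = refl
spine-encodeRow (b ∷ v) = cong suc (spine-encodeRow v)

xorFn-sem : ∀ (u v : Vec Bool m) → m ≤ N ℕ.^ 2 → ⟦ xorFn ⟧ N (cons (encodeRow u) (encodeRow v)) ≡ encodeRow (u ⊞ v)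
xorFn-sem {m} {N} u v m≤ = begin
  ⟦ for 2 pushStep ⟧ N (cons (tl (⟦ for 2 xorStep ⟧ N (cons (encodeRow u) (cons nil (cons (encodeRow v) nil))))) (cons nil nil))
    ≡⟨ cong (λ t → ⟦ for 2 pushStep ⟧ N (cons (tl t) (cons nil nil)))
         (trans (for-sem {N = N} 2 xorStep (encodeRow u) nil (cons (encodeRow v) nil) (ℕ.≤-trans (ℕ.≤-reflexive (spine-encodeRow u)) m≤))
                (sums u v nil)) ⟩
  ⟦ for 2 pushStep ⟧ N (cons (encodeRow-onto (u ⊞ v) nil) (cons nil nil))
    ≡⟨ for-sem {N = N} 2 pushStep (encodeRow-onto (u ⊞ v) nil) nil nil
         (ℕ.≤-trans (ℕ.≤-reflexive (trans (spine-onto (u ⊞ v) nil) (ℕ.+-identityʳ m))) m≤) ⟩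
  walk push (encodeRow-onto (u ⊞ v) nil) nil
    ≡⟨ pushes (u ⊞ v) nil nil ⟩
  append (u ⊞ v) nil
    ≡⟨ append-nil (u ⊞ v) ⟩
  encodeRow (u ⊞ v) ∎
  where
  open ≡-Reasoning
  push : Tree → Tree → Tree
  push c a = cons (hd c) a
  sums : ∀ {m} (u v : Vec Bool m) t → walk (λ c a → ⟦ xorStep ⟧ N (cons (cons c nil) a)) (encodeRow u) (cons (encodeRow v) t)
                                     ≡ cons nil (encodeRow-onto (u ⊞ v) t)
  sums []          []          t = refl
  sums (false ∷ u) (b ∷ v)     t = sums u v _
  sums (true ∷ u)  (false ∷ v) t = sums u v _
  sums (true ∷ u)  (true ∷ v)  t = sums u v _
  append : ∀ {m} → Vec Bool m → Tree → Tree
  append []      a = a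
  append (b ∷ v) a = cons (encodeBool b) (append v a)
  append-nil : ∀ {m} (v : Vec Bool m) → append v nil ≡ encodeRow v
  append-nil []      = refl
  append-nil (b ∷ v) = cong (cons (encodeBool b)) (append-nil v)
  pushes : ∀ {m} (v : Vec Bool m) t a → walk push (encodeRow-onto v t) a ≡ walk push t (append v a)
  pushes []      t a = refl
  pushes (b ∷ v) t a = pushes v (cons (encodeBool b) t) a

-- The box keeps even an empty pivot row, which is encoded by `nil`, apart from a missing one.
encodePivot : Maybe (Vec Bool m) → Tree
encodePivot nothing  = nil
encodePivot (just p) = cons (encodeRow p) nil

-- In the state ((rows , nil) , (pivot , out))
rowᵉ pivotᵉ outᵉ : Expr 1
rowᵉ   = hdᵉ (hdᵉ (hdᵉ arg))
pivotᵉ = hdᵉ (tlᵉ arg)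
outᵉ   = tlᵉ (tlᵉ arg)

eliminateStep : Fn
eliminateStep = cond (hdᵉ rowᵉ)
  (cond pivotᵉ
    (keep (expr (consᵉ (tlᵉ rowᵉ) (hdᵉ pivotᵉ)) ⟫ xorFn)
     ⟫ expr (consᵉ (hdᵉ (tlᵉ (tlᵉ arg))) (consᵉ (hdᵉ arg) (tlᵉ (tlᵉ (tlᵉ arg))))))
    (expr (consᵉ (consᵉ (tlᵉ rowᵉ) nilᵉ) outᵉ)))
  (expr (consᵉ pivotᵉ (consᵉ (tlᵉ rowᵉ) outᵉ)))

eliminateFn : Fn
eliminateFn = expr (consᵉ arg nilᵉ) ⟫ expr (consᵉ (hdᵉ arg) (consᵉ nilᵉ (consᵉ nilᵉ nilᵉ))) ⟫ for 6 eliminateStep ⟫ expr (tlᵉ arg)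

eliminateFn-sem : ∀ (rs : List (Vec Bool (suc m))) → length rs ≤ N ℕ.^ 6 → m ≤ N ℕ.^ 2 →
                  ⟦ eliminateFn ⟧ N (encodeRows rs) ≡ encodeRows (eliminate nothing [] rs)
eliminateFn-sem {m} {N} rs rs≤ m≤ = trans
  (cong tl (for-sem {N = N} 6 eliminateStep (encodeRows rs) nil (cons nil nil)
    (ℕ.≤-trans (ℕ.≤-reflexive (spine-encodeList encodeRow rs)) rs≤)))
  (go nothing [] rs)
  where
  step = λ c a → ⟦ eliminateStep ⟧ N (cons (cons c nil) a)
  go : ∀ p out rs → tl (walk step (encodeRows rs) (cons (encodePivot p) (encodeRows out))) ≡ encodeRows (eliminate {m} p out rs)
  go p        out []                 = refl
  go nothing  out ((false ∷ r) ∷ rs) = go nothing (r ∷ out) rs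
  go (just p) out ((false ∷ r) ∷ rs) = go (just p) (r ∷ out) rs
  go nothing  out ((true ∷ r) ∷ rs)  = go (just r) out rs
  go (just p) out ((true ∷ r) ∷ rs)  = trans
    (cong (λ v → tl (walk step (encodeRows rs) (cons (encodePivot (just p)) (cons v (encodeRows out))))) (xorFn-sem {N = N} r p m≤))
    (go (just p) (r ⊞ p ∷ out) rs)

-- A round never adds rows, so the loop bound for the initial system holds in all later rounds.
length-eliminate : ∀ p out (rs : List (Vec Bool (suc m))) → length (eliminate p out rs) ≤ length rs + length out
length-eliminate p        out []                 = ℕ.≤-refl
length-eliminate p        out ((false ∷ r) ∷ rs) = ℕ.≤-trans (length-eliminate p (r ∷ out) rs) (ℕ.≤-reflexive (ℕ.+-suc (length rs) (length out)))
length-eliminate nothing  out ((true ∷ r) ∷ rs)  = ℕ.m≤n⇒m≤1+n (length-eliminate (just r) out rs)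
length-eliminate (just p) out ((true ∷ r) ∷ rs)  = ℕ.≤-trans (length-eliminate (just p) (r ⊞ p ∷ out) rs) (ℕ.≤-reflexive (ℕ.+-suc (length rs) (length out)))

anyStep : Fn
anyStep = cond (hdᵉ rowᵉ) (expr trueᵉ) (expr (tlᵉ arg))

anyFn : Fn
anyFn = expr (consᵉ arg (consᵉ nilᵉ nilᵉ)) ⟫ for 6 anyStep

anyFn-sem : ∀ rs → length rs ≤ N ℕ.^ 6 → ⟦ anyFn ⟧ N (encodeRows rs) ≡ encodeBool (anyTrue false rs)
anyFn-sem {N} rs rs≤ = trans
  (for-sem {N = N} 6 anyStep (encodeRows rs) nil nil (ℕ.≤-trans (ℕ.≤-reflexive (spine-encodeList encodeRow rs)) rs≤))
  (go false rs)
  where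
  go : ∀ b rs → walk (λ c a → ⟦ anyStep ⟧ N (cons (cons c nil) a)) (encodeRows rs) (encodeBool b) ≡ encodeBool (anyTrue b rs)
  go b []                 = refl
  go b ((false ∷ []) ∷ rs) = go b rs
  go b ((true ∷ []) ∷ rs)  = go true rs

eliminationStep : Fn
eliminationStep = expr (tlᵉ arg) ⟫ eliminateFn

-- (columns , rows) ↦ the consistency of the rows, where only the number of columns is used
eliminationFn : Fn
eliminationFn = expr (consᵉ (hdᵉ arg) (consᵉ nilᵉ (tlᵉ arg))) ⟫ for 2 eliminationStep ⟫ anyFn

eliminationFn-sem : ∀ m cols rs → spine cols ≡ m → m ≤ N ℕ.^ 2 → length rs ≤ N ℕ.^ 6 →
                    ⟦ eliminationFn ⟧ N (cons cols (encodeRows rs)) ≡ encodeBool (inconsistent m rs)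
eliminationFn-sem {N} m cols rs cols≡ m≤ rs≤ = trans
  (cong (⟦ anyFn ⟧ N) (for-sem {N = N} 2 eliminationStep cols nil (encodeRows rs) (ℕ.≤-trans (ℕ.≤-reflexive cols≡) m≤)))
  (go m cols rs cols≡ m≤ rs≤)
  where
  step = λ c a → ⟦ eliminationStep ⟧ N (cons (cons c nil) a)
  go : ∀ m cols rs → spine cols ≡ m → m ≤ N ℕ.^ 2 → length rs ≤ N ℕ.^ 6 →
       ⟦ anyFn ⟧ N (walk step cols (encodeRows rs)) ≡ encodeBool (inconsistent m rs)
  go zero    nil        rs refl m≤ rs≤ = anyFn-sem {N} rs rs≤
  go (suc m) (cons h t) rs refl m≤ rs≤ = trans
    (cong (λ a → ⟦ anyFn ⟧ N (walk step t a)) (eliminateFn-sem {N = N} rs rs≤ m≤))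
    (go m t (eliminate nothing [] rs) refl (ℕ.≤-trans (ℕ.n≤1+n m) m≤)
      (ℕ.≤-trans (length-eliminate nothing [] rs) (ℕ.≤-trans (ℕ.≤-reflexive (ℕ.+-identityʳ (length rs))) rs≤)))

-- The decision procedure and its loop bounds

countStep : Fn
countStep = expr (consᵉ nilᵉ (tlᵉ arg))

-- The vertex count comes from the spine of the adjacency matrix. The column count is the length of
-- a zero row without its right-hand side, which is built only to drive the rounds of elimination.
answerFn : Fn
answerFn = keep (expr (consᵉ arg (consᵉ nilᵉ nilᵉ)) ⟫ for 1 countStep)
         ⟫ keep (expr (consᵉ arg nilᵉ) ⟫ rowsFn)
         ⟫ keep (expr (consᵉ (consᵉ (hdᵉ (tlᵉ arg)) nilᵉ) nilᵉ) ⟫ rowFn)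
         ⟫ expr (consᵉ (tlᵉ (hdᵉ arg)) (hdᵉ (tlᵉ arg)))
         ⟫ eliminationFn

length-allFin : ∀ n → length (allFin n) ≡ n
length-allFin n = length-tabulate {n = n} id

length-cartesianProduct : ∀ (xs : List A) (ys : List B) → length (cartesianProduct xs ys) ≡ length xs * length ys
length-cartesianProduct []       ys = refl
length-cartesianProduct (x ∷ xs) ys = trans (length-++ (map (x ,_) ys))
  (cong₂ _+_ (length-map (x ,_) ys) (length-cartesianProduct xs ys))

length-pairs : ∀ n → length (pairs n) ≡ n * n
length-pairs n = trans (length-cartesianProduct (allFin n) (allFin n)) (cong₂ _*_ (length-allFin n) (length-allFin n))

length-quads : ∀ n → length (quads n) ≡ n * (n * (n * n))
length-quads n = trans (length-cartesianProduct (allFin n) _) (cong₂ _*_ (length-allFin n)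
  (trans (length-cartesianProduct (allFin n) (pairs n)) (cong₂ _*_ (length-allFin n) (length-pairs n))))

length-rows : ∀ (G : Graph n) → length (rows G) ≤ length (quads n) * 3
length-rows {n} G = go (quads n)
  where
  emit≤ : ∀ x rs → length (emit G x rs) ≤ suc (length rs)
  emit≤ (B , A , c) rs with allAdj G true B
  ... | true  = ℕ.≤-refl
  ... | false = ℕ.n≤1+n _
  emits≤ : ∀ xs rs → length (foldl (λ rs x → emit G x rs) rs xs) ≤ length xs + length rs
  emits≤ []       rs = ℕ.≤-refl
  emits≤ (x ∷ xs) rs = ℕ.≤-trans (emits≤ xs (emit G x rs))
    (ℕ.≤-trans (ℕ.+-monoʳ-≤ (length xs) (emit≤ x rs)) (ℕ.≤-reflexive (ℕ.+-suc (length xs) (length rs))))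
  go : ∀ qs → length (foldr (λ q rs → foldl (λ rs x → emit G x rs) rs (candidates q)) [] qs) ≤ length qs * 3
  go []       = z≤n
  go (q ∷ qs) = ℕ.≤-trans (emits≤ (candidates q) _) (ℕ.+-monoʳ-≤ 3 (go qs))

module _ (G : Graph n) {M} (2≤M : 2 ≤ M) (n≤M : n ≤ M) where

  private
    square≡ : M * M ≡ M ℕ.^ 2
    square≡ = cong (M *_) (sym (ℕ.*-identityʳ M))

    4≤M² : 4 ≤ M ℕ.^ 2
    4≤M² = ℕ.≤-trans (ℕ.*-mono-≤ 2≤M 2≤M) (ℕ.≤-reflexive square≡)

    pairs≤ : length (pairs n) ≤ M ℕ.^ 2
    pairs≤ = ℕ.≤-trans (ℕ.≤-reflexive (length-pairs n)) (ℕ.≤-trans (ℕ.*-mono-≤ n≤M n≤M) (ℕ.≤-reflexive square≡))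

    -- Three candidates for each of the n ^ 4 quadruples, and 3 ≤ M ^ 2: hence the exponent 6 in the
    -- loops over rows.
    rows≤ : length (rows G) ≤ M ℕ.^ 6
    rows≤ = begin
      length (rows G)               ≤⟨ length-rows G ⟩
      length (quads n) * 3          ≡⟨ cong (_* 3) (length-quads n) ⟩
      n * (n * (n * n)) * 3         ≤⟨ ℕ.*-mono-≤ (ℕ.*-mono-≤ n≤M (ℕ.*-mono-≤ n≤M (ℕ.*-mono-≤ n≤M n≤M)))
                                                   (ℕ.≤-trans (ℕ.n≤1+n 3) 4≤M²) ⟩
      M * (M * (M * M)) * M ℕ.^ 2   ≡⟨ cong (λ t → M * (M * t) * M ℕ.^ 2) square≡ ⟩
      M ℕ.^ 4 * M ℕ.^ 2             ≡⟨ ℕ.^-distribˡ-+-* M 4 2 ⟨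
      M ℕ.^ 6                       ∎
      where open ℕ.≤-Reasoning

    count : ⟦ for 1 countStep ⟧ M (cons (encodeGraph G) (cons nil nil)) ≡ unary n
    count = trans
      (for-sem {N = M} 1 countStep (encodeGraph G) nil nil
        (ℕ.≤-trans (ℕ.≤-reflexive (trans (spine-encodeList _ (allFin n)) (length-allFin n)))
                   (ℕ.≤-trans n≤M (ℕ.≤-reflexive (sym (ℕ.*-identityʳ M))))))
      (trans (go (encodeGraph G) 0) (cong unary (trans (ℕ.+-identityʳ _) (trans (spine-encodeList _ (allFin n)) (length-allFin n)))))
      where
      go : ∀ t k → walk (λ c a → ⟦ countStep ⟧ M (cons (cons c nil) a)) t (unary k) ≡ unary (spine t + k)
      go nil        k = refl
      go (cons h t) k = trans (go t (suc k)) (cong unary (ℕ.+-suc (spine t) k))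

  answerFn-sem : ⟦ answerFn ⟧ M (encodeGraph G) ≡ encodeBool (answer G)
  answerFn-sem = begin
    ⟦ answerFn ⟧ M g
      ≡⟨ cong (λ u → ⟦ eliminationFn ⟧ M (cons (tl (⟦ rowFn ⟧ M (cons (cons u nil) nil))) (⟦ rowsFn ⟧ M (cons (cons u g) nil)))) count ⟩
    ⟦ eliminationFn ⟧ M (cons (tl (⟦ rowFn ⟧ M (cons (cons (unary n) nil) nil))) (⟦ rowsFn ⟧ M (cons (context G) nil)))
      ≡⟨ cong₂ (λ z r → ⟦ eliminationFn ⟧ M (cons (tl z) r)) (rowFn-sem {N = M} [] false n≤M z≤n) (rowsFn-sem {N = M} G n≤M 4≤M²) ⟩
    ⟦ eliminationFn ⟧ M (cons (tl (encodeRow (row [] false (pairs n)))) (encodeRows (rows G)))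
      ≡⟨ eliminationFn-sem {N = M} (length (pairs n)) _ (rows G) (zero-row (pairs n)) pairs≤ rows≤ ⟩
    encodeBool (answer G) ∎
    where
    open ≡-Reasoning
    g = encodeGraph G
    zero-row : ∀ cols → spine (tl (encodeRow (row [] false cols))) ≡ length cols
    zero-row []         = refl
    zero-row (a ∷ cols) = spine-encodeRow (row {n} [] false cols)

-- Recognition in polynomial time

suc-length≤size : ∀ {A : Set} (f : A → Tree) xs → suc (length xs) ≤ size (encodeList f xs)
suc-length≤size f []       = ℕ.≤-refl
suc-length≤size f (x ∷ xs) = s≤s (ℕ.≤-trans (suc-length≤size f xs) (ℕ.m≤n+m _ (size (f x))))

^-distribʳ-* : ∀ m k d → (m * k) ℕ.^ d ≡ m ℕ.^ d * k ℕ.^ d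
^-distribʳ-* m k zero    = refl
^-distribʳ-* m k (suc d) = trans (cong ((m * k) *_) (^-distribʳ-* m k d)) (ℕ.[m*n]*[o*p]≡[m*o]*[n*p] m k (m ℕ.^ d) (k ℕ.^ d))

module _ (f : Fn) (ans : ∀ {n} → Graph n → Bool)
         (f-sem : ∀ {n} (G : Graph n) {N} → 2 ≤ N → n ≤ N → ⟦ f ⟧ N (encodeGraph G) ≡ encodeBool (ans G)) where

  program : Program
  -- The encoded graph is a list of n rows, so two more cells give a counter of length n + 2. The 2
  -- ensures 4 ≤ N ^ 2 for small graphs too.
  program = record { auxiliary = 2 ; body = r₂ := consᵉ nilᵉ (consᵉ nilᵉ (reg r₀)) ⨾ compile f }

  -- The 6 pays for the initial assignment; the power of 2 comes from n + 2 ≤ 2 * s, where s is the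
  -- size of the input.
  bound : ∀ {n} → Graph n → ℕ
  bound G = (6 + factor f) * 2 ℕ.^ degree f * size (encodeGraph G) ℕ.^ degree f

  program-time : ∀ {n} (G : Graph n) → 6 + time f (2 + n) ≤ bound G
  program-time {n} G = begin
    6 + time f M                    ≤⟨ +-bound M 6 c 0 d (const≤ M 6 0) (time≤ M f) ⟩
    (6 + c) * M ℕ.^ d               ≤⟨ ℕ.*-monoʳ-≤ (6 + c) (ℕ.^-monoˡ-≤ d M≤2s) ⟩
    (6 + c) * (2 * s) ℕ.^ d         ≡⟨ cong ((6 + c) *_) (^-distribʳ-* 2 s d) ⟩
    (6 + c) * (2 ℕ.^ d * s ℕ.^ d)   ≡⟨ ℕ.*-assoc (6 + c) (2 ℕ.^ d) (s ℕ.^ d) ⟨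
    (6 + c) * 2 ℕ.^ d * s ℕ.^ d     ∎
    where
    open ℕ.≤-Reasoning
    M = 2 + n
    c = factor f
    d = degree f
    s = size (encodeGraph G)
    n<s : suc n ≤ s
    n<s = ℕ.≤-trans (ℕ.≤-reflexive (cong suc (sym (length-allFin n)))) (suc-length≤size _ (allFin n))
    M≤2s : M ≤ 2 * s
    M≤2s = ℕ.≤-trans (ℕ.+-mono-≤ (ℕ.≤-trans (s≤s z≤n) n<s) n<s) (ℕ.≤-reflexive (cong (s +_) (sym (ℕ.+-identityʳ s))))

  program-computes : ∀ {n} (G : Graph n) → program on encodeGraph G yields encodeBool (ans G) within bound G
  program-computes {n} G =
    let t , p , t≤ = run f {2 + n} (encodeGraph G) nil (cons nil (cons nil (encodeGraph G)))
                       (cong (2 +_) (trans (spine-encodeList _ (allFin n)) (length-allFin n)))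
    in _ , 6 + t , run-⨾ run-:= p , f-sem G (ℕ.m≤m+n 2 n) (ℕ.m≤n+m n 2) ,
       ℕ.≤-trans (ℕ.+-monoʳ-≤ 6 t≤) (program-time G)

  reflected⇒recognizable : ∀ {P : ∀ {n} → Graph n → Set} → (∀ {n} (G : Graph n) → Reflects (P G) (ans G)) →
                           PolynomialTimeRecognizable P
  reflected⇒recognizable reflects = program , (6 + factor f) * 2 ℕ.^ degree f , degree f ,
                                    λ G → ans G , program-computes G , reflects G

recognizable : PolynomialTimeRecognizable (λ G → ¬ ThreeColorable G × HasDegreeOneCertificate G)
recognizable = reflected⇒recognizable answerFn answer answerFn-sem (λ G → correct G (answer G) refl)
  where
  correct : ∀ {n} (G : Graph n) b → answer G ≡ b → Reflects (¬ ThreeColorable G × HasDegreeOneCertificate G) b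
  correct G true  eq = ofʸ
    -- A colouring would give a solution, which refutes the certificate just derived.
    ( (λ colouring → solution⇒¬certificate G (proj₂ (colouring⇒solution G colouring)) (true⇒certificate G eq))
    , true⇒certificate G eq )
  correct G false eq = ofⁿ λ (_ , certificate) → solution⇒¬certificate G (proj₂ (false⇒solution G eq)) certificate

theorem2p1 : (∀ (n : ℕ) (G : Graph n) →
    HasDegreeOneCertificate G
    ⇔
    Σ (CycleSet G) λ C →
    (∀ (i j : Fin n) → Adj G i j → (∣ C ∣at (i , j) + ∣ C ∣at (j , i)) % 2 ≡ 0)
    × sum (map (λ a → ∣ C ∣at a) (upArcs G)) % 2 ≡ 1)
    × PolynomialTimeRecognizable (λ G → ¬ ThreeColorable G × HasDegreeOneCertificate G)
theorem2p1 = (λ n G → equivalence G (answer G) refl) , recognizable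
  where
  equivalence : ∀ {n} (G : Graph n) b → answer G ≡ b → HasDegreeOneCertificate G ⇔ Σ (CycleSet G) (CycleCondition G)
  equivalence G true  eq = mk⇔ (λ _ → true⇒cycles G eq) (λ _ → true⇒certificate G eq)
  equivalence G false eq = let _ , sol = false⇒solution G eq in
    mk⇔ (λ certificate → contradiction certificate (solution⇒¬certificate G sol))
        (λ cycles → contradiction cycles (solution⇒¬cycles G sol))
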